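{- Let $n\ge2$. The poset $P_n$ of endgame moves is a symmetric modular lattice: it is a modular lattice (with rank function $\rho((i,j))=\mathrm{level}(i)+2j$, one has $\rho(x)+\rho(y)=\rho(x\vee y)+\rho(x\wedge y)$ for all $x,y\in P_n$), the map $(i,j)\mapsto(i',j)$ with $i'=2^{\mathrm{level}(i)}+2^{\mathrm{level}(i)-1}-1-i$ is an automorphism of $P_n$, and the map $(i,j)\mapsto(i,\,n-1-\mathrm{level}(i)-j)$ is an anti-automorphism of $P_n$.
   Context: Setting: the infinite binary tree with nodes labeled by positive integers (root $1$; node $i$ has left child $2i$, right child $2i+1$, parent $\lfloor i/2\rfloor$ for $i>1$), with a self-loop at the root; $\mathrm{level}(i)=\lfloor\log_2 i\rfloor+1$. Labeled chip-firing: a node holding at least $3$ chips may fire any $3$ of them, sending the smallest to its left child, the largest to its right child and the middle one to its parent (the root keeps it). Start with $2^n-1$ chips labeled $1,\dots,2^n-1$ at the root; a complete firing sequence is a finite sequence of legal firings ending in a configuration where no node holds $3$ or more chips. In every complete firing sequence each node fires the same number of times; $(i,j)$ denotes the $(j+1)$-th-to-last firing of node $i$ ($j\ge0$). $P_n$ is the set of moves $(i,j)$ with $\mathrm{level}(i)+j<n$, partially ordered by $(i_2,j_2)\le(i_1,j_1)$ if and only if in every complete firing sequence $(i_1,j_1)$ does not occur after $(i_2,j_2)$. The word "symmetric" is understood as the existence of the stated left-right automorphism and top-bottom anti-automorphism. -}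

module Defs where

open import Data.Nat using (ℕ; zero; suc; _+_; _*_; _∸_; _^_; _≤_; _<_; _≟_; ⌊_/2⌋)
open import Data.Nat.Logarithm using (⌊log₂_⌋)
open import Data.List using (List; []; _∷_; _++_; length)
open import Data.Product using (Σ; _×_; _,_; ∃; ∃-syntax)
open import Data.Empty using (⊥)
open import Relation.Nullary using (¬_; yes; no)
open import Relation.Binary.PropositionalEquality using (_≡_)
open import Relation.Binary.Lattice.Structures using (IsLattice)
open import Function.Bundles using (_⇔_)

-- The infinite binary tree (nodes are positive naturals)

level : ℕ → ℕ
level i = suc ⌊log₂ i ⌋

-- parent, with the root's self-loop
parent : ℕ → ℕ
parent (suc zero) = 1
parent i          = ⌊ i /2⌋

-- Labeled chip-firing.  A configuration records, for every chip label,
-- the node at which that chip lies (only labels 1..N are relevant).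

Config : Set
Config = ℕ → ℕ

chips : ℕ → ℕ
chips n = 2 ^ n ∸ 1

initial : Config
initial _ = 1

record Firing : Set where
  constructor firing
  field
    node : ℕ
    lo   : ℕ
    mid  : ℕ
    hi   : ℕ
open Firing public

LegalFiring : ℕ → Config → Firing → Set
LegalFiring N pos f =
  1 ≤ lo f × lo f < mid f × mid f < hi f × hi f ≤ N ×
  pos (lo f) ≡ node f × pos (mid f) ≡ node f × pos (hi f) ≡ node f

fire : Firing → Config → Config
fire f pos k with k ≟ lo f
... | yes _ = 2 * node f
... | no _ with k ≟ mid f
...   | yes _ = parent (node f)
...   | no _ with k ≟ hi f
...     | yes _ = 2 * node f + 1
...     | no _  = pos k

data Legal (N : ℕ) : Config → List Firing → Set where
  []  : ∀ {pos} → Legal N pos []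
  _∷_ : ∀ {pos f fs} → LegalFiring N pos f → Legal N (fire f pos) fs →
        Legal N pos (f ∷ fs)

run : Config → List Firing → Config
run pos []       = pos
run pos (f ∷ fs) = run (fire f pos) fs

Stable : ℕ → Config → Set
Stable N pos = ∀ a b c → 1 ≤ a → a < b → b < c → c ≤ N →
               pos a ≡ pos b → pos b ≡ pos c → ⊥

Complete : ℕ → List Firing → Set
Complete n fs = Legal (chips n) initial fs × Stable (chips n) (run initial fs)

countNode : ℕ → List Firing → ℕ
countNode i [] = 0
countNode i (f ∷ fs) with node f ≟ i
... | yes _ = suc (countNode i fs)
... | no _  = countNode i fs

-- move (i , j) (the (j+1)-th-to-last firing of node i) is the t-th
-- entry (0-based) of fs
OccursAt : List Firing → ℕ → ℕ → ℕ → Set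
OccursAt fs i j t =
  ∃[ pre ] ∃[ f ] ∃[ post ]
    (fs ≡ pre ++ f ∷ post) × (length pre ≡ t) × (node f ≡ i) × (countNode i post ≡ j)

MoveLe : ℕ → ℕ × ℕ → ℕ × ℕ → Set
MoveLe n (i₂ , j₂) (i₁ , j₁) =
  ∀ fs → Complete n fs → ∀ t₁ t₂ →
    OccursAt fs i₁ j₁ t₁ → OccursAt fs i₂ j₂ t₂ → t₁ ≤ t₂

record Elem (n : ℕ) : Set where
  constructor elem
  field
    i     : ℕ
    j     : ℕ
    i-pos : 1 ≤ i
    bound : level i + j < n
open Elem public

_≈P_ : ∀ {n} → Elem n → Elem n → Set
x ≈P y = (i x ≡ i y) × (j x ≡ j y)

_≤P_ : ∀ {n} → Elem n → Elem n → Set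
_≤P_ {n} x y = MoveLe n (i x , j x) (i y , j y)

_<P_ : ∀ {n} → Elem n → Elem n → Set
x <P y = x ≤P y × ¬ (x ≈P y)

ρ : ∀ {n} → Elem n → ℕ
ρ x = level (i x) + 2 * j x

-- left-right mirror of a node within its level
mirror : ℕ → ℕ
mirror i = 2 ^ level i + 2 ^ (level i ∸ 1) ∸ 1 ∸ i

IsRankedModularLattice : (n : ℕ) → (Elem n → Elem n → Elem n) →
                         (Elem n → Elem n → Elem n) → Set
IsRankedModularLattice n _∨_ _∧_ =
  IsLattice _≈P_ _≤P_ _∨_ _∧_ ×
  (∀ x y z → x ≤P z → (x ∨ (y ∧ z)) ≈P ((x ∨ y) ∧ z)) ×
  (∀ x y → ρ x + ρ y ≡ ρ (x ∨ y) + ρ (x ∧ y)) ×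
  (∀ (x y : Elem n) → x <P y → (∀ z → x <P z → z <P y → ⊥) → ρ y ≡ suc (ρ x))

IsAutomorphism : (n : ℕ) → (Elem n → Elem n) → Set
IsAutomorphism n φ =
  (∀ x y → φ x ≈P φ y → x ≈P y) × (∀ y → ∃[ x ] φ x ≈P y) ×
  (∀ x y → (x ≤P y) ⇔ (φ x ≤P φ y))

IsAntiAutomorphism : (n : ℕ) → (Elem n → Elem n) → Set
IsAntiAutomorphism n ψ =
  (∀ x y → ψ x ≈P ψ y → x ≈P y) × (∀ y → ∃[ x ] ψ x ≈P y) ×
  (∀ x y → (x ≤P y) ⇔ (ψ y ≤P ψ x))

{-# OPTIONS --safe #-}
module Submission where

open import Defs
open import Data.Bool using (Bool; true; false; not)
open import Data.Bool.Properties using (not-involutive)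
open import Data.Empty using (⊥; ⊥-elim)
open import Data.List using (List; []; _∷_; _++_; length; map; take; drop; _∷ʳ_; _ʳ++_)
open import Data.List.Properties using (length-++; ++-assoc; ++-identityʳ; take++drop≡id; length-map; length-take; map-∘; map-id; map-cong; ∷-injective)
open import Data.Nat
open import Data.Nat.Induction using (<-wellFounded)
open import Data.Nat.Logarithm using (⌊log₂_⌋; ⌊log₂⌋-mono-≤; ⌊log₂⌊n/2⌋⌋≡⌊log₂n⌋∸1)
open import Data.Nat.Properties
open import Data.Nat.Tactic.RingSolver using (solve-∀)
open import Data.Product using (_×_; _,_; proj₁; proj₂; ∃-syntax)
open import Data.Sum using (_⊎_; inj₁; inj₂; [_,_]′)
import Data.Sum as Sum
open import Function using (_∘_)
open import Function.Bundles using (mk⇔)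
open import Induction.WellFounded using (Acc; acc)
open import Relation.Binary.Lattice.Structures using (IsLattice)
open import Relation.Binary.PropositionalEquality using (_≡_; _≢_; refl; sym; trans; cong; cong₂; subst; subst₂; ≢-sym; module ≡-Reasoning)
open import Relation.Nullary using (¬_; yes; no; contradiction)
open import Relation.Nullary.Decidable using (toSum; decidable-stable; _×-dec_)

-- Let cl(v,w) be the level of the last common ancestor of v and w.  The order turns out to be
--   (v,k) ≤ (w,m)  iff  level v + k ≤ m + cl(v,w).
-- If u(v) is the number of firings of v still to come, then v holds 1 + 3u(v) - Σ u(w) chips, the
-- sum being over the neighbours w, and at least as many chips as there are neighbours that have
-- fired since v last did.  Going backwards from the stable configuration these two facts force
-- every node to alternate with its parent throughout the endgame, which gives "if".
-- For "only if", play until exactly (w,m) and the moves that have to follow it by this rule are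
-- left.  This is possible greedily: with d(v) firings of v to go, a node maximising d (ties broken
-- by the number of moves left afterwards, then by the label) can fire.
-- In this description of the order, joins keep the larger level + j and move towards the root until
-- both elements are dominated; the anti-automorphism exchanges level + j and n - 1 - j and so
-- provides meets.  Modularity follows because the rank is a strictly monotone valuation.

-- The bound behind alternation has no slack. Let r(w) be 1 if the neighbour w has fired since v,
-- and 0 otherwise. The two facts give Σ (u(w) + r(w)) ≤ 1 + 3u(v). In an alternating endgame the
-- parent contributes u(v) + 1 and each child u(v), which exhausts the bound, so control of two
-- neighbours pins down the third. The condition level v + j < n enters because v fires at least n -
-- level v times in all: a node in its endgame has already fired, so "since v last did" has its
-- proper meaning. The loop fits the pattern, since a firing leaves one chip on the root, as though
-- from a parent that has always just fired. In the greedy direction a remainder h is a possible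
-- target because its Laplacian 3h(v) - Σ h(w) lies between -1 and 2 at every node; the tie-breaks
-- supply what is missing to three chips.

-- Linear arithmetic: A ≤ B is the sum of the hypotheses and k is the slack.
linear : ∀ {A B a b} k → A ≤ B → a + B + k ≡ b + A → a ≤ b
linear {A} {B} {a} {b} k A≤B eq = +-cancelʳ-≤ A a b (begin
  a + A     ≤⟨ +-monoʳ-≤ a A≤B ⟩
  a + B     ≤⟨ m≤m+n (a + B) k ⟩
  a + B + k ≡⟨ eq ⟩
  b + A     ∎)
  where open ≤-Reasoning

infixl 6 _⊞_
_⊞_ : ∀ {a b c d} → a ≤ b → c ≤ d → a + c ≤ b + d
_⊞_ = +-mono-≤

-- The tree

2*suc : ∀ x → 2 * suc x ≡ suc (suc (2 * x))
2*suc = solve-∀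

half-even : ∀ x → ⌊ 2 * x /2⌋ ≡ x
half-even zero = refl
half-even (suc x) rewrite +-suc x (x + 0) = cong suc (half-even x)

half-odd : ∀ x → ⌊ 2 * x + 1 /2⌋ ≡ x
half-odd zero = refl
half-odd (suc x) rewrite +-suc x (x + 0) = cong suc (half-odd x)

child : ℕ → Bool → ℕ
child v false = 2 * v
child v true  = 2 * v + 1

child-pos : ∀ v b → 1 ≤ v → 2 ≤ child v b
child-pos v false 1≤v = *-monoʳ-≤ 2 1≤v
child-pos v true  1≤v = ≤-trans (*-monoʳ-≤ 2 1≤v) (m≤m+n (2 * v) 1)

child-> : ∀ v b → 1 ≤ v → v < child v b
child-> v false 1≤v = linear 0 1≤v (lem v)
  where lem : ∀ v → suc v + v + 0 ≡ 2 * v + 1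
        lem = solve-∀
child-> v true 1≤v = ≤-trans (child-> v false 1≤v) (m≤m+n (2 * v) 1)

half-child : ∀ v b → ⌊ child v b /2⌋ ≡ v
half-child v false = half-even v
half-child v true  = half-odd v

parent-half : ∀ v → 2 ≤ v → parent v ≡ ⌊ v /2⌋
parent-half (suc (suc v)) _ = refl
parent-half (suc zero) (s≤s ())

parent-child : ∀ v b → 1 ≤ v → parent (child v b) ≡ v
parent-child v b 1≤v =
  trans (parent-half (child v b) (child-pos v b 1≤v)) (half-child v b)

parent-pos : ∀ v → 1 ≤ v → 1 ≤ parent v
parent-pos (suc zero)    _ = s≤s z≤n
parent-pos (suc (suc v)) _ = s≤s z≤n

as-half : ∀ v → ∃[ b ] v ≡ child ⌊ v /2⌋ b
as-half zero = false , refl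
as-half (suc zero) = true , refl
as-half (suc (suc v)) with as-half v
... | false , eq = false , trans (cong (suc ∘ suc) eq) (sym (2*suc ⌊ v /2⌋))
... | true  , eq = true , trans (cong (suc ∘ suc) eq) (cong (_+ 1) (sym (2*suc ⌊ v /2⌋)))

data NodeView : ℕ → Set where
  root    : NodeView 1
  childOf : ∀ v b → 1 ≤ v → NodeView (child v b)

nodeView : ∀ v → 1 ≤ v → NodeView v
nodeView (suc zero) _ = root
nodeView v@(suc (suc w)) _ with as-half v
... | b , eq = subst NodeView (sym eq) (childOf ⌊ v /2⌋ b (s≤s z≤n))

level-half : ∀ v → 2 ≤ v → level v ≡ suc (level ⌊ v /2⌋)
level-half v 2≤v = cong suc (trans (sym (m∸n+n≡m 1≤log))
  (trans (+-comm _ 1) (cong suc (sym (⌊log₂⌊n/2⌋⌋≡⌊log₂n⌋∸1 v)))))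
  where
  1≤log : 1 ≤ ⌊log₂ v ⌋
  1≤log = ⌊log₂⌋-mono-≤ 2≤v

level-child : ∀ v b → 1 ≤ v → level (child v b) ≡ suc (level v)
level-child v b 1≤v = trans (level-half (child v b) (child-pos v b 1≤v))
  (cong (suc ∘ level) (half-child v b))

-- Kronecker delta, by structural recursion so that it reduces under `suc` and can follow the
-- recursion of halving in `ind-half`.
ind : ℕ → ℕ → ℕ
ind zero    zero    = 1
ind zero    (suc y) = 0
ind (suc x) zero    = 0
ind (suc x) (suc y) = ind x y

ind-refl : ∀ x → ind x x ≡ 1
ind-refl zero    = refl
ind-refl (suc x) = ind-refl x

ind-≢ : ∀ {x y} → x ≢ y → ind x y ≡ 0
ind-≢ {zero}  {zero}  x≢y = contradiction refl x≢y
ind-≢ {zero}  {suc y} x≢y = refl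
ind-≢ {suc x} {zero}  x≢y = refl
ind-≢ {suc x} {suc y} x≢y = ind-≢ (x≢y ∘ cong suc)

ind-sym : ∀ x y → ind x y ≡ ind y x
ind-sym zero    zero    = refl
ind-sym zero    (suc y) = refl
ind-sym (suc x) zero    = refl
ind-sym (suc x) (suc y) = ind-sym x y

ind-half : ∀ x v → ind ⌊ x /2⌋ v ≡ ind x (2 * v) + ind x (2 * v + 1)
ind-half zero          zero    = refl
ind-half (suc zero)    zero    = refl
ind-half (suc (suc x)) zero    = refl
ind-half zero          (suc v) = refl
ind-half (suc zero)    (suc v) rewrite +-suc v (v + 0) = refl
ind-half (suc (suc x)) (suc v) rewrite +-suc v (v + 0) = ind-half x v

-- The sum of g over the neighbours of v, where parent 1 = 1 accounts for the loop.
nbr : (ℕ → ℕ) → ℕ → ℕ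
nbr g v = g (parent v) + (g (2 * v) + g (2 * v + 1))

nbr-cong : ∀ {g h : ℕ → ℕ} v → 1 ≤ v → (∀ w → 1 ≤ w → g w ≡ h w) → nbr g v ≡ nbr h v
nbr-cong v 1≤v eq = cong₂ _+_ (eq (parent v) (parent-pos v 1≤v))
  (cong₂ _+_ (eq _ (≤-trans (s≤s z≤n) (child-pos v false 1≤v)))
             (eq _ (≤-trans (s≤s z≤n) (child-pos v true 1≤v))))

nbr-mono : ∀ {g h : ℕ → ℕ} v → 1 ≤ v → (∀ w → 1 ≤ w → g w ≤ h w) → nbr g v ≤ nbr h v
nbr-mono v 1≤v le = le (parent v) (parent-pos v 1≤v)
  ⊞ (le _ (≤-trans (s≤s z≤n) (child-pos v false 1≤v))
     ⊞ le _ (≤-trans (s≤s z≤n) (child-pos v true 1≤v)))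

nbr-+ : ∀ (g h : ℕ → ℕ) v → nbr (λ w → g w + h w) v ≡ nbr g v + nbr h v
nbr-+ g h v = lem (g (parent v)) (g (2 * v)) (g (2 * v + 1))
                  (h (parent v)) (h (2 * v)) (h (2 * v + 1))
  where
  lem : ∀ a b c d e f → a + d + (b + e + (c + f)) ≡ a + (b + c) + (d + (e + f))
  lem = solve-∀

-- Both sides count the ways in which a firing of x sends a chip to v.
receive : ∀ x v → 1 ≤ x → 1 ≤ v →
  ind (2 * x) v + ind (2 * x + 1) v + ind (parent x) v ≡ nbr (ind x) v
receive 1 1 _ _ = refl
receive 1 v@(suc (suc w)) _ _ =
  cong (_+ 0) (trans (cong₂ _+_ (ind-sym 2 v) (ind-sym 3 v))
            (trans (sym (ind-half v 1)) (ind-sym ⌊ v /2⌋ 1)))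
receive x@(suc (suc y)) 1 _ _ = ind-half x 1
receive x@(suc (suc y)) v@(suc (suc w)) _ _ = cong₂ _+_
  (trans (cong₂ _+_ (ind-sym (2 * x) v) (ind-sym (2 * x + 1) v))
     (trans (sym (ind-half v x)) (ind-sym ⌊ v /2⌋ x)))
  (ind-half x v)

nbr-child : ∀ (g : ℕ → ℕ) v b → nbr g v ≡ g (parent v) + (g (child v b) + g (child v (not b)))
nbr-child g v false = refl
nbr-child g v true  = cong (g (parent v) +_) (+-comm (g (2 * v)) (g (2 * v + 1)))

child-≢-sibling : ∀ v b → child v b ≢ child v (not b)
child-≢-sibling v false = <⇒≢ (subst (2 * v <_) (+-comm 1 (2 * v)) ≤-refl)
child-≢-sibling v true  = ≢-sym (child-≢-sibling v false)

-- Labelled chips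

count : Config → ℕ → ℕ → ℕ
count pos v zero    = 0
count pos v (suc m) = ind (pos (suc m)) v + count pos v m

count-cong : ∀ {pos pos′ : Config} v m → (∀ k → pos k ≡ pos′ k) → count pos v m ≡ count pos′ v m
count-cong v zero    eq = refl
count-cong v (suc m) eq = cong₂ _+_ (cong (λ x → ind x v) (eq (suc m))) (count-cong v m eq)

count-initial : ∀ v m → count initial v m ≡ m * ind 1 v
count-initial v zero    = refl
count-initial v (suc m) = cong (ind 1 v +_) (count-initial v m)

-- A firing is treated as three relocations of single chips, so that chip counts only have to be
-- followed through one relocation.
move : Config → ℕ → ℕ → Config
move pos a w k with k ≟ a
... | yes _ = w
... | no  _ = pos k

move-at : ∀ pos a w → move pos a w a ≡ w
move-at pos a w with a ≟ a
... | yes _   = refl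
... | no  a≢a = contradiction refl a≢a

move-off : ∀ pos a w {k} → k ≢ a → move pos a w k ≡ pos k
move-off pos a w {k} k≢a with k ≟ a
... | yes k≡a = contradiction k≡a k≢a
... | no  _   = refl

count-move-off : ∀ pos a w v m → m < a → count (move pos a w) v m ≡ count pos v m
count-move-off pos a w v zero    m<a = refl
count-move-off pos a w v (suc m) m<a = cong₂ _+_
  (cong (λ x → ind x v) (move-off pos a w (<⇒≢ m<a)))
  (count-move-off pos a w v m (<-trans (n<1+n m) m<a))

count-move : ∀ pos a w v m → 1 ≤ a → a ≤ m →
  count (move pos a w) v m + ind (pos a) v ≡ count pos v m + ind w v
count-move pos a w v zero    1≤a a≤m = contradiction (≤-trans 1≤a a≤m) (λ ())
count-move pos a w v (suc m) 1≤a a≤m with m≤n⇒m<n∨m≡n a≤m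
... | inj₂ refl rewrite move-at pos (suc m) w | count-move-off pos (suc m) w v m ≤-refl =
  lem (ind w v) (count pos v m) (ind (pos (suc m)) v)
  where
  lem : ∀ a b c → a + b + c ≡ c + b + a
  lem = solve-∀
... | inj₁ a<sm rewrite move-off pos a w (≢-sym (<⇒≢ a<sm)) =
  trans (+-assoc (ind (pos (suc m)) v) _ _)
    (trans (cong (ind (pos (suc m)) v +_) (count-move pos a w v m 1≤a (s≤s⁻¹ a<sm)))
      (sym (+-assoc (ind (pos (suc m)) v) _ _)))

-- The outermost relocation wins when labels coincide, so the nesting mirrors the order of the tests
-- in `fire`.
fire-as-moves : ∀ f pos k → fire f pos k ≡
  move (move (move pos (hi f) (2 * node f + 1)) (mid f) (parent (node f))) (lo f) (2 * node f) k
fire-as-moves f pos k with k ≟ lo f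
... | yes _ = refl
... | no _ with k ≟ mid f
...   | yes _ = refl
...   | no _ with k ≟ hi f
...     | yes _ = refl
...     | no _  = refl

-- The labels are distinct, so each relocation finds its chip still on `node f`; `receive` then
-- turns the three arrivals into adjacency. The additive form avoids truncated subtraction and
-- covers the root, where the middle chip leaves and returns.
count-fire : ∀ {N pos f} v → LegalFiring N pos f → 1 ≤ node f → 1 ≤ v →
  count (fire f pos) v N + 3 * ind (node f) v ≡ count pos v N + nbr (ind (node f)) v
count-fire {N} {pos} {f} v (1≤a , a<b , b<c , c≤N , pa , pb , pc) 1≤x 1≤v
  = trans (cong (_+ 3 * ind x v) (count-cong v N (fire-as-moves f pos)))
      (trans (lem (count pos₃ v N) (count pos₂ v N) (count pos₁ v N) (count pos v N) (ind x v)
                  (ind (2 * x) v) (ind (2 * x + 1) v) (ind (parent x) v) step₁ step₂ step₃)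
        (cong (count pos v N +_) (receive x v 1≤x 1≤v)))
  where
  x = node f
  pos₁ = move pos (hi f) (2 * x + 1)
  pos₂ = move pos₁ (mid f) (parent x)
  pos₃ = move pos₂ (lo f) (2 * x)
  step₁ : count pos₁ v N + ind x v ≡ count pos v N + ind (2 * x + 1) v
  step₁ = subst (λ y → count pos₁ v N + ind y v ≡ count pos v N + ind (2 * x + 1) v) pc
    (count-move pos (hi f) _ v N (<⇒≤ (≤-trans (s≤s 1≤a) (<-trans a<b b<c))) c≤N)
  step₂ : count pos₂ v N + ind x v ≡ count pos₁ v N + ind (parent x) v
  step₂ = subst (λ y → count pos₂ v N + ind y v ≡ count pos₁ v N + ind (parent x) v)
    (trans (move-off pos (hi f) _ (<⇒≢ b<c)) pb)
    (count-move pos₁ (mid f) _ v N (<⇒≤ (≤-trans (s≤s 1≤a) a<b)) (≤-trans (<⇒≤ b<c) c≤N))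
  step₃ : count pos₃ v N + ind x v ≡ count pos₂ v N + ind (2 * x) v
  step₃ = subst (λ y → count pos₃ v N + ind y v ≡ count pos₂ v N + ind (2 * x) v)
    (trans (move-off pos₁ (mid f) _ (<⇒≢ a<b))
      (trans (move-off pos (hi f) _ (<⇒≢ (<-trans a<b b<c))) pa))
    (count-move pos₂ (lo f) _ v N 1≤a (≤-trans (<⇒≤ (<-trans a<b b<c)) c≤N))
  lem : ∀ c₃ c₂ c₁ c i l r p → c₁ + i ≡ c + r → c₂ + i ≡ c₁ + p → c₃ + i ≡ c₂ + l →
    c₃ + 3 * i ≡ c + (l + r + p)
  lem c₃ c₂ c₁ c i l r p e₁ e₂ e₃ = begin
    c₃ + 3 * i           ≡⟨ s₁ c₃ i ⟩
    (c₃ + i) + i + i     ≡⟨ cong (λ z → z + i + i) e₃ ⟩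
    (c₂ + l) + i + i     ≡⟨ s₂ c₂ l i ⟩
    (c₂ + i) + l + i     ≡⟨ cong (λ z → z + l + i) e₂ ⟩
    (c₁ + p) + l + i     ≡⟨ s₃ c₁ p l i ⟩
    (c₁ + i) + p + l     ≡⟨ cong (λ z → z + p + l) e₁ ⟩
    (c + r) + p + l      ≡⟨ s₄ c r p l ⟩
    c + (l + r + p)      ∎
    where
    open ≡-Reasoning
    s₁ : ∀ c₃ i → c₃ + 3 * i ≡ (c₃ + i) + i + i
    s₁ = solve-∀
    s₂ : ∀ c₂ l i → (c₂ + l) + i + i ≡ (c₂ + i) + l + i
    s₂ = solve-∀
    s₃ : ∀ c₁ p l i → (c₁ + p) + l + i ≡ (c₁ + i) + p + l
    s₃ = solve-∀
    s₄ : ∀ c r p l → (c + r) + p + l ≡ c + (l + r + p)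
    s₄ = solve-∀

-- Takes off the largest label found on `v`. Doing this three times yields labels already in the
-- order that legality demands.
count-split : ∀ pos v m k → suc k ≤ count pos v m →
  ∃[ a ] suc a ≤ m × pos (suc a) ≡ v × k ≤ count pos v a
count-split pos v (suc m) k le with pos (suc m) ≟ v
... | yes refl rewrite ind-refl (pos (suc m)) = m , ≤-refl , refl , s≤s⁻¹ le
... | no  ≢v rewrite ind-≢ ≢v with count-split pos v m k le
...   | a , a<m , eq , le′ = a , m≤n⇒m≤1+n a<m , eq , le′

three-chips : ∀ pos v N → 3 ≤ count pos v N → ∃[ a ] ∃[ b ] ∃[ c ]
  1 ≤ a × a < b × b < c × c ≤ N × pos a ≡ v × pos b ≡ v × pos c ≡ v
three-chips pos v N le with count-split pos v N 2 le
... | c , c<N , pc , le₂ with count-split pos v c 1 le₂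
...   | b , b<c , pb , le₁ with count-split pos v b 0 le₁
...     | a , a<b , pa , _ =
  suc a , suc b , suc c , s≤s z≤n , s≤s a<b , s≤s b<c , c<N , pa , pb , pc

count-mono : ∀ pos v {a m} → a ≤ m → count pos v a ≤ count pos v m
count-mono pos v {m = zero} z≤n = ≤-refl
count-mono pos v {a} {suc m} a≤m with m≤n⇒m<n∨m≡n a≤m
... | inj₂ refl = ≤-refl
... | inj₁ a<sm = ≤-trans (count-mono pos v (s≤s⁻¹ a<sm)) (m≤n+m _ _)

count-suc : ∀ pos v {a b} → pos b ≡ v → a < b → suc (count pos v a) ≤ count pos v b
count-suc pos v {a} {suc b} refl a<b rewrite ind-refl (pos (suc b)) =
  s≤s (count-mono pos v (s≤s⁻¹ a<b))

two-chips : ∀ pos N {a b} → 1 ≤ a → a < b → b ≤ N → pos a ≡ pos b → 2 ≤ count pos (pos a) N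
two-chips pos N {a} {b} 1≤a a<b b≤N eq =
  ≤-trans (s≤s (≤-trans (s≤s z≤n) (count-suc pos (pos a) {0} {a} refl 1≤a)))
    (≤-trans (count-suc pos (pos a) (sym eq) a<b) (count-mono pos (pos a) b≤N))

-- Firing sequences

countNode-∷ : ∀ v g gs → countNode v (g ∷ gs) ≡ ind (node g) v + countNode v gs
countNode-∷ v g gs with node g ≟ v
... | yes refl rewrite ind-refl (node g) = refl
... | no  x≢v  rewrite ind-≢ x≢v = refl

countNode-++ : ∀ v fs gs → countNode v (fs ++ gs) ≡ countNode v fs + countNode v gs
countNode-++ v []       gs = refl
countNode-++ v (f ∷ fs) gs with node f ≟ v
... | yes _ = cong suc (countNode-++ v fs gs)
... | no  _ = countNode-++ v fs gs

-- recent past w v = 1 if w has fired since the last firing of v, and 0 otherwise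
-- (the most recent firing comes first in past).
recent : List Firing → ℕ → ℕ → ℕ
recent []         w v = 0
recent (f ∷ past) w v with node f ≟ w | node f ≟ v
... | yes _ | _     = 1
... | no  _ | yes _ = 0
... | no  _ | no  _ = recent past w v

recent-hit : ∀ f past w v → node f ≡ w → recent (f ∷ past) w v ≡ 1
recent-hit f past w v x≡w with node f ≟ w | node f ≟ v
... | yes _   | _ = refl
... | no  x≢w | _ = contradiction x≡w x≢w

recent-own : ∀ f past w v → node f ≡ v → recent (f ∷ past) w v ≡ ind (node f) w
recent-own f past w v x≡v with node f ≟ w | node f ≟ v
... | yes refl | _       = sym (ind-refl (node f))
... | no  x≢w  | yes _   = sym (ind-≢ x≢w)
... | no  _    | no  x≢v = contradiction x≡v x≢v

recent-skip : ∀ f past w v → node f ≢ w → node f ≢ v → recent (f ∷ past) w v ≡ recent past w v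
recent-skip f past w v x≢w x≢v with node f ≟ w | node f ≟ v
... | yes x≡w | _       = contradiction x≡w x≢w
... | no  _   | yes x≡v = contradiction x≡v x≢v
... | no  _   | no  _   = refl

recent-other : ∀ f past w v → node f ≢ v →
  recent (f ∷ past) w v ≤ recent past w v + ind (node f) w
recent-other f past w v x≢v with node f ≟ w | node f ≟ v
... | yes refl | _     rewrite ind-refl (node f) = m≤n+m 1 _
... | no  _    | yes _ = z≤n
... | no  _    | no  _ = m≤m+n _ _

-- Whichever of the two fired last has fired since the other one did, and not conversely.
recent-pair : ∀ past w v → w ≢ v → 1 ≤ countNode v past → recent past w v + recent past v w ≡ 1
recent-pair (f ∷ past) w v w≢v fired with node f ≟ w | node f ≟ v
... | yes refl | yes refl = contradiction refl w≢v
... | yes refl | no  _    = refl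
... | no  _    | yes refl = refl
... | no  _    | no  _    = recent-pair past w v w≢v fired

-- `recent` tests for `w` before `v`, so a firing of `v` counts as recent for `v` itself. This
-- records the chip that the root keeps through its loop.
recent-self : ∀ past v → 1 ≤ countNode v past → recent past v v ≡ 1
recent-self (f ∷ past) v fired with node f ≟ v
... | yes refl = refl
... | no  _    = recent-self past v fired

countNode-hit : ∀ v g gs → node g ≡ v → countNode v (g ∷ gs) ≡ suc (countNode v gs)
countNode-hit v g gs refl = trans (countNode-∷ v g gs) (cong (_+ countNode v gs) (ind-refl v))

countNode-skip : ∀ v g gs → node g ≢ v → countNode v (g ∷ gs) ≡ countNode v gs
countNode-skip v g gs x≢v = trans (countNode-∷ v g gs) (cong (_+ countNode v gs) (ind-≢ x≢v))

later-suffix : ∀ {A : Set} pre₁ pre₂ {f₁ f₂ : A} {post₁ post₂} →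
  pre₁ ++ f₁ ∷ post₁ ≡ pre₂ ++ f₂ ∷ post₂ → length pre₁ < length pre₂ →
  ∃[ mid ] post₁ ≡ mid ++ f₂ ∷ post₂
later-suffix []         (x ∷ pre₂) eq _  = pre₂ , proj₂ (∷-injective eq)
later-suffix (x ∷ pre₁) (y ∷ pre₂) eq lt =
  later-suffix pre₁ pre₂ (proj₂ (∷-injective eq)) (s≤s⁻¹ lt)

occurrence : ∀ i j fs → j < countNode i fs → ∃[ pre ] ∃[ f ] ∃[ post ]
  fs ≡ pre ++ f ∷ post × node f ≡ i × countNode i post ≡ j
occurrence i j (f ∷ fs) lt with node f ≟ i
... | no _ with occurrence i j fs lt
...   | pre , g , post , refl , eq , cnt = f ∷ pre , g , post , refl , eq , cnt
occurrence i j (f ∷ fs) lt | yes x≡i with m≤n⇒m<n∨m≡n (s≤s⁻¹ lt)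
... | inj₂ refl = [] , f , fs , refl , x≡i , refl
... | inj₁ lt′ with occurrence i j fs lt′
...   | pre , g , post , refl , eq , cnt = f ∷ pre , g , post , refl , eq , cnt

run-++ : ∀ pos fs gs → run pos (fs ++ gs) ≡ run (run pos fs) gs
run-++ pos []       gs = refl
run-++ pos (f ∷ fs) gs = run-++ (fire f pos) fs gs

Legal-++ : ∀ {N pos} fs {gs} → Legal N pos fs → Legal N (run pos fs) gs → Legal N pos (fs ++ gs)
Legal-++ []       []      ls′ = ls′
Legal-++ (f ∷ fs) (l ∷ ls) ls′ = l ∷ Legal-++ fs ls ls′

-- Binary words and nodes

nodeFrom : ℕ → List Bool → ℕ
nodeFrom a []      = a
nodeFrom a (b ∷ p) = nodeFrom (child a b) p

nodeFrom-++ : ∀ a p q → nodeFrom a (p ++ q) ≡ nodeFrom (nodeFrom a p) q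
nodeFrom-++ a []      q = refl
nodeFrom-++ a (b ∷ p) q = nodeFrom-++ (child a b) p q

nodeFrom-pos : ∀ a p → 1 ≤ a → 1 ≤ nodeFrom a p
nodeFrom-pos a []      1≤a = 1≤a
nodeFrom-pos a (b ∷ p) 1≤a = nodeFrom-pos (child a b) p (<⇒≤ (child-pos a b 1≤a))

level-nodeFrom : ∀ a p → 1 ≤ a → level (nodeFrom a p) ≡ level a + length p
level-nodeFrom a []      1≤a = sym (+-identityʳ _)
level-nodeFrom a (b ∷ p) 1≤a = trans (level-nodeFrom (child a b) p (<⇒≤ (child-pos a b 1≤a)))
  (trans (cong (_+ length p) (level-child a b 1≤a)) (sym (+-suc (level a) (length p))))

child-injective : ∀ v b w c → child v b ≡ child w c → v ≡ w × b ≡ c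
child-injective v b w c eq
  with trans (sym (half-child v b)) (trans (cong ⌊_/2⌋ eq) (half-child w c))
child-injective v false w false eq | refl = refl , refl
child-injective v true  w true  eq | refl = refl , refl
child-injective v false w true  eq | refl = contradiction eq (child-≢-sibling v false)
child-injective v true  w false eq | refl = contradiction eq (child-≢-sibling v true)

nodeFrom-injective : ∀ v p w q → length p ≡ length q → nodeFrom v p ≡ nodeFrom w q → v ≡ w × p ≡ q
nodeFrom-injective v []      w []      _  eq = eq , refl
nodeFrom-injective v (b ∷ p) w (c ∷ q) ℓ≡ eq
  with nodeFrom-injective (child v b) p (child w c) q (suc-injective ℓ≡) eq
... | eq₁ , refl with child-injective v b w c eq₁
...   | refl , refl = refl , refl

locate : ∀ v → 1 ≤ v → ∃[ p ] nodeFrom 1 p ≡ v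
locate v 1≤v = go v 1≤v (<-wellFounded v)
  where
  go : ∀ v → 1 ≤ v → Acc _<_ v → ∃[ p ] nodeFrom 1 p ≡ v
  go v 1≤v (acc rs) with nodeView v 1≤v
  ... | root = [] , refl
  ... | childOf w b 1≤w with go w 1≤w (rs (child-> w b 1≤w))
  ...   | p , eq = p ∷ʳ b , trans (nodeFrom-++ 1 p (b ∷ [])) (cong (λ z → child z b) eq)

path : ℕ → List Bool
-- `0` is not a node; the value is arbitrary.
path zero    = []
path (suc v) = proj₁ (locate (suc v) (s≤s z≤n))

node-path : ∀ v → 1 ≤ v → nodeFrom 1 (path v) ≡ v
node-path (suc v) _ = proj₂ (locate (suc v) (s≤s z≤n))

level-path : ∀ v → 1 ≤ v → level v ≡ suc (length (path v))
level-path v 1≤v = trans (cong level (sym (node-path v 1≤v))) (level-nodeFrom 1 (path v) ≤-refl)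

path-node : ∀ p → path (nodeFrom 1 p) ≡ p
path-node p = proj₂ (nodeFrom-injective 1 (path v) 1 p
    (suc-injective (trans (sym (level-path v 1≤v)) (level-nodeFrom 1 p ≤-refl)))
    (node-path v 1≤v))
  where
  v = nodeFrom 1 p
  1≤v = nodeFrom-pos 1 p ≤-refl

path-child : ∀ v b → 1 ≤ v → path (child v b) ≡ path v ∷ʳ b
path-child v b 1≤v = trans (cong path (sym (trans (nodeFrom-++ 1 (path v) (b ∷ []))
  (cong (λ z → child z b) (node-path v 1≤v))))) (path-node (path v ∷ʳ b))

common : List Bool → List Bool → ℕ
common []          q           = 0
common (x ∷ p)     []          = 0
common (true ∷ p)  (true ∷ q)  = suc (common p q)
common (true ∷ p)  (false ∷ q) = 0
common (false ∷ p) (true ∷ q)  = 0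
common (false ∷ p) (false ∷ q) = suc (common p q)

common-sym : ∀ p q → common p q ≡ common q p
common-sym []          []          = refl
common-sym []          (y ∷ q)     = refl
common-sym (x ∷ p)     []          = refl
common-sym (true ∷ p)  (true ∷ q)  = cong suc (common-sym p q)
common-sym (true ∷ p)  (false ∷ q) = refl
common-sym (false ∷ p) (true ∷ q)  = refl
common-sym (false ∷ p) (false ∷ q) = cong suc (common-sym p q)

common-≤ : ∀ p q → common p q ≤ length p
common-≤ []          q           = z≤n
common-≤ (x ∷ p)     []          = z≤n
common-≤ (true ∷ p)  (true ∷ q)  = s≤s (common-≤ p q)
common-≤ (true ∷ p)  (false ∷ q) = z≤n
common-≤ (false ∷ p) (true ∷ q)  = z≤n
common-≤ (false ∷ p) (false ∷ q) = s≤s (common-≤ p q)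

-- `p` and `r` both agree with `q` up to the shorter of the two overlaps, hence with each other.
common-ultrametric : ∀ p q r → common p q ≤ common p r ⊎ common q r ≤ common p r
common-ultrametric []          q           r           = inj₁ z≤n
common-ultrametric (x ∷ p)     []          r           = inj₁ z≤n
common-ultrametric (x ∷ p)     (y ∷ q)     []          = inj₂ z≤n
common-ultrametric (true ∷ p)  (false ∷ q) (z ∷ r)     = inj₁ z≤n
common-ultrametric (false ∷ p) (true ∷ q)  (z ∷ r)     = inj₁ z≤n
common-ultrametric (true ∷ p)  (true ∷ q)  (false ∷ r) = inj₂ z≤n
common-ultrametric (false ∷ p) (false ∷ q) (true ∷ r)  = inj₂ z≤n
common-ultrametric (true ∷ p)  (true ∷ q)  (true ∷ r)  = Sum.map s≤s s≤s (common-ultrametric p q r)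
common-ultrametric (false ∷ p) (false ∷ q) (false ∷ r) = Sum.map s≤s s≤s (common-ultrametric p q r)

common-prefix : ∀ p s t → common (p ++ s) (p ++ t) ≡ length p + common s t
common-prefix []          s t = refl
common-prefix (true ∷ p)  s t = cong suc (common-prefix p s t)
common-prefix (false ∷ p) s t = cong suc (common-prefix p s t)

common-split : ∀ p q → ∃[ c ] ∃[ s ] ∃[ t ] p ≡ c ++ s × q ≡ c ++ t × length c ≡ common p q
common-split []          q           = [] , [] , q , refl , refl , refl
common-split (x ∷ p)     []          = [] , x ∷ p , [] , refl , refl , refl
common-split (true ∷ p)  (false ∷ q) = [] , true ∷ p , false ∷ q , refl , refl , refl
common-split (false ∷ p) (true ∷ q)  = [] , false ∷ p , true ∷ q , refl , refl , refl
common-split (true ∷ p)  (true ∷ q) with common-split p q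
... | c , s , t , refl , refl , eq = true ∷ c , s , t , refl , refl , cong suc eq
common-split (false ∷ p) (false ∷ q) with common-split p q
... | c , s , t , refl , refl , eq = false ∷ c , s , t , refl , refl , cong suc eq

common-++ : ∀ p r q → common p q ≡ length p ⊓ common (p ++ r) q
common-++ []          r q           = refl
common-++ (x ∷ p)     r []          = refl
common-++ (true ∷ p)  r (true ∷ q)  = cong suc (common-++ p r q)
common-++ (true ∷ p)  r (false ∷ q) = refl
common-++ (false ∷ p) r (true ∷ q)  = refl
common-++ (false ∷ p) r (false ∷ q) = cong suc (common-++ p r q)

common-full : ∀ p q → common p q ≡ length p → ∃[ r ] q ≡ p ++ r
common-full []          q           _  = q , refl
common-full (true ∷ p)  (true ∷ q)  eq with common-full p q (suc-injective eq)
... | r , refl = r , refl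
common-full (false ∷ p) (false ∷ q) eq with common-full p q (suc-injective eq)
... | r , refl = r , refl

common-not : ∀ p q → common (map not p) (map not q) ≡ common p q
common-not []          q           = refl
common-not (x ∷ p)     []          = refl
common-not (true ∷ p)  (true ∷ q)  = cong suc (common-not p q)
common-not (true ∷ p)  (false ∷ q) = refl
common-not (false ∷ p) (true ∷ q)  = refl
common-not (false ∷ p) (false ∷ q) = cong suc (common-not p q)

common-self : ∀ p → common p p ≡ length p
common-self []          = refl
common-self (true ∷ p)  = cong suc (common-self p)
common-self (false ∷ p) = cong suc (common-self p)

common-equal : ∀ p q → length q ≤ common p q → length p ≤ length q → p ≡ q
common-equal []          []          _         _         = refl
common-equal (true ∷ p)  (true ∷ q)  (s≤s le)  (s≤s le′) = cong (true ∷_) (common-equal p q le le′)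
common-equal (false ∷ p) (false ∷ q) (s≤s le)  (s≤s le′) = cong (false ∷_) (common-equal p q le le′)

common-take : ∀ k p q → k ≤ length p → common (take k p) q ≡ k ⊓ common p q
common-take k p q k≤ = trans (common-++ (take k p) (drop k p) q)
  (cong₂ (λ m r → m ⊓ common r q) (trans (length-take k p) (m≤n⇒m⊓n≡m k≤)) (take++drop≡id k p))

-- Taking opposite children on the two sides doubles `v + w + 1`, whichever child it is on the left.
nodeFrom-not : ∀ v w p →
  nodeFrom v p + nodeFrom w (map not p) + 1 ≡ (v + w + 1) * 2 ^ length p
nodeFrom-not v w []      = sym (*-identityʳ _)
nodeFrom-not v w (b ∷ p) = trans (nodeFrom-not (child v b) (child w (not b)) p)
  (trans (cong (_* 2 ^ length p) (kids b)) (lem (v + w + 1) (2 ^ length p)))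
  where
  kids : ∀ b → child v b + child w (not b) + 1 ≡ (v + w + 1) * 2
  kids false = lem′ v w
    where
    lem′ : ∀ v w → 2 * v + (2 * w + 1) + 1 ≡ (v + w + 1) * 2
    lem′ = solve-∀
  kids true = lem′ v w
    where
    lem′ : ∀ v w → 2 * v + 1 + 2 * w + 1 ≡ (v + w + 1) * 2
    lem′ = solve-∀
  lem : ∀ a q → a * 2 * q ≡ a * (2 * q)
  lem = solve-∀

-- Reversing a level sends `v` to (first + last) - v. On the level at depth k the ends are 2^k and
-- 2^(k+1) - 1, with sum 3 * 2^k - 1, the constant that `nodeFrom-not` gives when both sides start
-- at the root.
mirror-path : ∀ v → 1 ≤ v → mirror v ≡ nodeFrom 1 (map not (path v))
mirror-path v 1≤v = begin
  2 ^ level v + 2 ^ (level v ∸ 1) ∸ 1 ∸ v   ≡⟨ cong (λ ℓ → 2 ^ ℓ + 2 ^ (ℓ ∸ 1) ∸ 1 ∸ v) (level-path v 1≤v) ⟩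
  2 ^ suc k + 2 ^ k ∸ 1 ∸ v                 ≡⟨ cong (λ z → z ∸ 1 ∸ v) (trans (lem (2 ^ k)) (sym eq)) ⟩
  v + w + 1 ∸ 1 ∸ v                         ≡⟨ cong (_∸ v) (m+n∸n≡m (v + w) 1) ⟩
  v + w ∸ v                                 ≡⟨ m+n∸m≡n v w ⟩
  w                                         ∎
  where
  open ≡-Reasoning
  k = length (path v)
  w = nodeFrom 1 (map not (path v))
  eq : v + w + 1 ≡ 3 * 2 ^ k
  eq = trans (cong (λ z → z + w + 1) (sym (node-path v 1≤v))) (nodeFrom-not 1 1 (path v))
  lem : ∀ q → 2 * q + q ≡ 3 * q
  lem = solve-∀

path-mirror : ∀ v → 1 ≤ v → path (mirror v) ≡ map not (path v)
path-mirror v 1≤v = trans (cong path (mirror-path v 1≤v)) (path-node (map not (path v)))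

mirror-pos : ∀ v → 1 ≤ v → 1 ≤ mirror v
mirror-pos v 1≤v = subst (1 ≤_) (sym (mirror-path v 1≤v)) (nodeFrom-pos 1 (map not (path v)) ≤-refl)

level-mirror : ∀ v → 1 ≤ v → level (mirror v) ≡ level v
level-mirror v 1≤v = trans (level-path (mirror v) (mirror-pos v 1≤v)) (trans
  (cong suc (trans (cong length (path-mirror v 1≤v)) (length-map not (path v))))
  (sym (level-path v 1≤v)))

mirror-involutive : ∀ v → 1 ≤ v → mirror (mirror v) ≡ v
mirror-involutive v 1≤v = begin
  mirror (mirror v)                         ≡⟨ mirror-path (mirror v) (mirror-pos v 1≤v) ⟩
  nodeFrom 1 (map not (path (mirror v)))    ≡⟨ cong (nodeFrom 1 ∘ map not) (path-mirror v 1≤v) ⟩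
  nodeFrom 1 (map not (map not (path v)))   ≡⟨ cong (nodeFrom 1) (trans (sym (map-∘ (path v)))
                                                 (trans (map-cong not-involutive (path v)) (map-id (path v)))) ⟩
  nodeFrom 1 (path v)                       ≡⟨ node-path v 1≤v ⟩
  v                                         ∎
  where open ≡-Reasoning

-- Odometer and greedy firing

-- A node of level n - k fires F k = 2^(k+1) - k - 2 times in all.
F : ℕ → ℕ
F zero    = 0
F (suc k) = 2 * F k + suc k

-- Chip balance of a node of level n - k below the root that ends with one chip: one arrival per
-- firing of the parent or of a child, three departures per own firing. At k = 0 the truncated
-- `pred` is right, since nothing below level n fires.
F-recurrence : ∀ k → F (suc k) + (F (pred k) + F (pred k)) ≡ 3 * F k + 1
F-recurrence zero    = refl
F-recurrence (suc k) = lem (F k) k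
  where
  lem : ∀ x k → 2 * (2 * x + suc k) + suc (suc k) + (x + x) ≡ 3 * (2 * x + suc k) + 1
  lem = solve-∀

F-power : ∀ k → F k + (k + 2) ≡ 2 ^ suc k
F-power zero    = refl
F-power (suc k) = trans (lem (F k) k) (cong (2 *_) (F-power k))
  where
  lem : ∀ x k → 2 * x + suc k + (suc k + 2) ≡ 2 * (x + (k + 2))
  lem = solve-∀

k≤Fk : ∀ k → k ≤ F k
k≤Fk zero    = z≤n
k≤Fk (suc k) = m≤n+m (suc k) (2 * F k)

-- Balance at the root, after cancelling the root's own term contributed by the loop. This is where
-- the number 2^n - 1 of chips enters.
chips-root : ∀ n → 2 ≤ n → chips n + 2 * F (n ∸ 2) ≡ 2 * F (n ∸ 1) + 1
chips-root (suc zero) (s≤s ())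
chips-root (suc (suc m)) _ = +-cancelʳ-≡ 1 _ _ (begin
  2 ^ suc (suc m) ∸ 1 + 2 * F m + 1   ≡⟨ s₁ (2 ^ suc (suc m) ∸ 1) (F m) ⟩
  2 ^ suc (suc m) ∸ 1 + 1 + 2 * F m
    ≡⟨ cong (_+ 2 * F m) (m∸n+n≡m (m^n>0 2 (suc (suc m)))) ⟩
  2 * 2 ^ suc m + 2 * F m             ≡⟨ cong (λ z → 2 * z + 2 * F m) (sym (F-power m)) ⟩
  2 * (F m + (m + 2)) + 2 * F m       ≡⟨ s₂ (F m) m ⟩
  2 * (2 * F m + suc m) + 1 + 1       ∎)
  where
  open ≡-Reasoning
  s₁ : ∀ a x → a + 2 * x + 1 ≡ a + 1 + 2 * x
  s₁ = solve-∀
  s₂ : ∀ x m → 2 * (x + (m + 2)) + 2 * x ≡ 2 * (2 * x + suc m) + 1 + 1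
  s₂ = solve-∀

-- The possible values of a target h at the parent of a node, the node itself and its two children.
data Shape : ℕ → ℕ → ℕ → ℕ → Set where
  flat  : Shape 0 0 0 0
  rim   : Shape 1 0 0 0
  tip   : ∀ m → Shape (suc m) (suc m) m m
  pathˡ : ∀ m → Shape (suc m) (suc m) (suc m) m
  pathʳ : ∀ m → Shape (suc m) (suc m) m (suc m)
  slope : ∀ m → Shape (suc (suc m)) (suc m) m m

ShapeAt : (ℕ → ℕ) → ℕ → Set
ShapeAt h v = Shape (h (parent v)) (h v) (h (2 * v)) (h (2 * v + 1))

-- Solving for `c` gives 1 + (3hv - hp - hl - hr) + (dv - dp) + (dv - dl) + (dv - dr). The part from
-- h is 2 at a `tip`, 1 on `pathˡ`, `pathʳ` and `slope`, 0 for `flat` and -1 for `rim`, so 0, 1, 2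
-- or 3 of the differences have to be positive; the premises provide exactly these.
shape-fires : ∀ {hp hv hl hr} c dp dv dl dr → Shape hp hv hl hr →
  dp ≤ dv → dl ≤ dv → dr ≤ dv →
  (hv < hp → dp < dv) → (hv ≤ hl → dl < dv) → (hv ≤ hr → dr < dv) →
  c + (hp + dp + (hl + dl + (hr + dr))) ≡ 1 + 3 * (hv + dv) → 3 ≤ c
shape-fires c dp dv dl dr flat p l r p′ l′ r′ eq =
  linear 0 (≤-reflexive (sym eq) ⊞ p ⊞ l′ z≤n ⊞ r′ z≤n) (lem c dp dv dl dr)
  where
  lem : ∀ c dp dv dl dr → 3 + (c + (dp + (dl + dr)) + dv + dv + dv) + 0
    ≡ c + (1 + 3 * dv + dp + suc dl + suc dr)
  lem = solve-∀
shape-fires c dp dv dl dr rim p l r p′ l′ r′ eq =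
  linear 0 (≤-reflexive (sym eq) ⊞ p′ (s≤s z≤n) ⊞ l′ z≤n ⊞ r′ z≤n) (lem c dp dv dl dr)
  where
  lem : ∀ c dp dv dl dr → 3 + (c + (1 + dp + (dl + dr)) + dv + dv + dv) + 0
    ≡ c + (1 + 3 * dv + suc dp + suc dl + suc dr)
  lem = solve-∀
shape-fires c dp dv dl dr (tip m) p l r p′ l′ r′ eq =
  linear 0 (≤-reflexive (sym eq) ⊞ p ⊞ l ⊞ r) (lem c dp dv dl dr m)
  where
  lem : ∀ c dp dv dl dr m → 3 + (c + (suc m + dp + (m + dl + (m + dr))) + dv + dv + dv) + 0
    ≡ c + (1 + 3 * (suc m + dv) + dp + dl + dr)
  lem = solve-∀
shape-fires c dp dv dl dr (pathˡ m) p l r p′ l′ r′ eq =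
  linear 0 (≤-reflexive (sym eq) ⊞ p ⊞ l′ ≤-refl ⊞ r) (lem c dp dv dl dr m)
  where
  lem : ∀ c dp dv dl dr m → 3 + (c + (suc m + dp + (suc m + dl + (m + dr))) + dv + dv + dv) + 0
    ≡ c + (1 + 3 * (suc m + dv) + dp + suc dl + dr)
  lem = solve-∀
shape-fires c dp dv dl dr (pathʳ m) p l r p′ l′ r′ eq =
  linear 0 (≤-reflexive (sym eq) ⊞ p ⊞ l ⊞ r′ ≤-refl) (lem c dp dv dl dr m)
  where
  lem : ∀ c dp dv dl dr m → 3 + (c + (suc m + dp + (m + dl + (suc m + dr))) + dv + dv + dv) + 0
    ≡ c + (1 + 3 * (suc m + dv) + dp + dl + suc dr)
  lem = solve-∀
shape-fires c dp dv dl dr (slope m) p l r p′ l′ r′ eq =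
  linear 0 (≤-reflexive (sym eq) ⊞ p′ ≤-refl ⊞ l ⊞ r) (lem c dp dv dl dr m)
  where
  lem : ∀ c dp dv dl dr m → 3 + (c + (suc (suc m) + dp + (m + dl + (m + dr))) + dv + dv + dv) + 0
    ≡ c + (1 + 3 * (suc m + dv) + suc dp + dl + dr)
  lem = solve-∀

-- Ties go to the largest label. Children have larger labels than their parent, so this is what
-- makes comparisons with children strict.
last-argmax : ∀ (key : ℕ → ℕ) M → ∃[ v ] 1 ≤ v × v ≤ suc M ×
  (∀ w → 1 ≤ w → w ≤ suc M → key w ≤ key v) × (∀ w → v < w → w ≤ suc M → key w < key v)
last-argmax key zero = 1 , ≤-refl , ≤-refl ,
  (λ w 1≤w w≤1 → ≤-reflexive (cong key (≤-antisym w≤1 1≤w))) ,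
  (λ w 1<w w≤1 → contradiction w≤1 (<⇒≱ 1<w))
last-argmax key (suc M) with last-argmax key M
... | v , 1≤v , v≤M , max , last with key v ≤? key (suc (suc M))
...   | yes le = suc (suc M) , s≤s z≤n , ≤-refl , max′ , (λ w <w w≤ → contradiction w≤ (<⇒≱ <w))
  where
  max′ : ∀ w → 1 ≤ w → w ≤ suc (suc M) → key w ≤ key (suc (suc M))
  max′ w 1≤w w≤ with m≤n⇒m<n∨m≡n w≤
  ... | inj₁ (s≤s w≤M) = ≤-trans (max w 1≤w w≤M) le
  ... | inj₂ refl      = ≤-refl
...   | no ≰ = v , 1≤v , m≤n⇒m≤1+n v≤M , max′ , last′
  where
  max′ : ∀ w → 1 ≤ w → w ≤ suc (suc M) → key w ≤ key v
  max′ w 1≤w w≤ with m≤n⇒m<n∨m≡n w≤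
  ... | inj₁ (s≤s w≤M) = max w 1≤w w≤M
  ... | inj₂ refl      = <⇒≤ (≰⇒> ≰)
  last′ : ∀ w → v < w → w ≤ suc (suc M) → key w < key v
  last′ w v<w w≤ with m≤n⇒m<n∨m≡n w≤
  ... | inj₁ (s≤s w≤M) = last w v<w w≤M
  ... | inj₂ refl      = ≰⇒> ≰

-- For h < K the number d * K + h orders pairs lexicographically, so a single numerical maximum
-- realises both criteria.
module Lex (K : ℕ) where

  lex-≤ : ∀ {d d′ h h′} → h < K → d′ * K + h′ ≤ d * K + h → d′ ≤ d
  lex-≤ {d} {d′} {h} {h′} h<K le with d′ ≤? d
  ... | yes d′≤d = d′≤d
  ... | no  d′≰d = contradiction le (<⇒≱ (begin-strict
    d * K + h    <⟨ +-monoʳ-< (d * K) h<K ⟩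
    d * K + K    ≡⟨ +-comm (d * K) K ⟩
    suc d * K    ≤⟨ *-monoˡ-≤ K (≰⇒> d′≰d) ⟩
    d′ * K       ≤⟨ m≤m+n (d′ * K) h′ ⟩
    d′ * K + h′  ∎))
    where open ≤-Reasoning

  lex-< : ∀ {d d′ h h′} → h < K → h ≤ h′ → d′ * K + h′ < d * K + h → d′ < d
  lex-< {d} {d′} {h} {h′} h<K h≤h′ lt with m≤n⇒m<n∨m≡n (lex-≤ {d} {d′} {h} {h′} h<K (<⇒≤ lt))
  ... | inj₁ d′<d = d′<d
  ... | inj₂ refl = contradiction (+-cancelˡ-< (d * K) h′ h lt) (≤⇒≯ h≤h′)

  lex-<′ : ∀ {d d′ h h′} → h < K → h < h′ → d′ * K + h′ ≤ d * K + h → d′ < d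
  lex-<′ {d} {d′} {h} {h′} h<K h<h′ le with m≤n⇒m<n∨m≡n (lex-≤ {d} {d′} {h} {h′} h<K le)
  ... | inj₁ d′<d = d′<d
  ... | inj₂ refl = contradiction (+-cancelˡ-≤ (d * K) h′ h le) (<⇒≱ h<h′)

sumTo : (ℕ → ℕ) → ℕ → ℕ
sumTo d zero    = 0
sumTo d (suc m) = d (suc m) + sumTo d m

sumTo-cong : ∀ {d e : ℕ → ℕ} m → (∀ v → d v ≡ e v) → sumTo d m ≡ sumTo e m
sumTo-cong zero    eq = refl
sumTo-cong (suc m) eq = cong₂ _+_ (eq (suc m)) (sumTo-cong m eq)

sumTo-+ : ∀ (d e : ℕ → ℕ) m → sumTo (λ v → d v + e v) m ≡ sumTo d m + sumTo e m
sumTo-+ d e zero = refl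
sumTo-+ d e (suc m) rewrite sumTo-+ d e m = lem (d (suc m)) (e (suc m)) (sumTo d m) (sumTo e m)
  where
  lem : ∀ a b c d → a + b + (c + d) ≡ a + c + (b + d)
  lem = solve-∀

≤-sumTo : ∀ (d : ℕ → ℕ) v m → 1 ≤ v → v ≤ m → d v ≤ sumTo d m
≤-sumTo d v zero    1≤v v≤m = contradiction (≤-trans 1≤v v≤m) (λ ())
≤-sumTo d v (suc m) 1≤v v≤m with m≤n⇒m<n∨m≡n v≤m
... | inj₂ refl      = m≤m+n _ _
... | inj₁ (s≤s v≤m′) = ≤-trans (≤-sumTo d v m 1≤v v≤m′) (m≤n+m _ _)

sumTo-pos : ∀ (d : ℕ → ℕ) m → 1 ≤ sumTo d m → ∃[ v ] 1 ≤ v × v ≤ m × 1 ≤ d v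
sumTo-pos d (suc m) le with d (suc m) in eq
... | suc k = suc m , s≤s z≤n , ≤-refl , subst (1 ≤_) (sym eq) (s≤s z≤n)
... | zero with sumTo-pos d m le
...   | v , 1≤v , v≤m , pos = v , 1≤v , m≤n⇒m≤1+n v≤m , pos

v<2^level : ∀ v → 1 ≤ v → v < 2 ^ level v
v<2^level v 1≤v = go v 1≤v (<-wellFounded v)
  where
  open import Induction.WellFounded using (Acc; acc)
  go : ∀ v → 1 ≤ v → Acc _<_ v → v < 2 ^ level v
  go v 1≤v (acc rs) with nodeView v 1≤v
  ... | root = s≤s (s≤s z≤n)
  ... | childOf w b 1≤w = subst (λ ℓ → child w b < 2 ^ ℓ) (sym (level-child w b 1≤w))
    (lem w b (2 ^ level w) (go w 1≤w (rs (child-> w b 1≤w))))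
    where
    lem : ∀ w b p → w < p → child w b < 2 * p
    lem w false p w<p = *-monoʳ-< 2 w<p
    lem w true  p w<p = linear 0 (w<p ⊞ w<p) (lem′ w p)
      where
      lem′ : ∀ w p → suc (2 * w + 1) + (p + p) + 0 ≡ 2 * p + (suc w + suc w)
      lem′ = solve-∀

-- The number of moves (v , m) below the move (e , H - 1), where p and e are the paths of the nodes:
-- H on the path from the root to e, and one less for every step away from it.
height : ℕ → List Bool → List Bool → ℕ
height H e p = (H + common p e) ∸ length p

height-on : ∀ H e p → common p e ≡ length p → height H e p ≡ H
height-on H e p eq = trans (cong (λ z → (H + z) ∸ length p) eq) (m+n∸n≡m H (length p))

length-snoc : ∀ (p : List Bool) b → length (p ∷ʳ b) ≡ suc (length p)
length-snoc p b = trans (length-++ p) (+-comm (length p) 1)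

height-on-child : ∀ H p b r → height H (p ++ r) (p ∷ʳ b) ≡ (H + common (b ∷ []) r) ∸ 1
height-on-child H p b r = begin
  (H + common (p ∷ʳ b) (p ++ r)) ∸ length (p ∷ʳ b)
    ≡⟨ cong₂ (λ x y → (H + x) ∸ y) (common-prefix p (b ∷ []) r) (length-snoc p b) ⟩
  (H + (length p + k)) ∸ suc (length p)
    ≡⟨ cong₂ _∸_ (lem H (length p) k) (+-comm 1 (length p)) ⟩
  (length p + (H + k)) ∸ (length p + 1)
    ≡⟨ [m+n]∸[m+o]≡n∸o (length p) (H + k) 1 ⟩
  (H + k) ∸ 1 ∎
  where
  open ≡-Reasoning
  k = common (b ∷ []) r
  lem : ∀ a b c → a + (b + c) ≡ b + (a + c)
  lem = solve-∀

-- On the path to `e` a child keeps the value `H` if the path continues through it and otherwise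
-- loses one. The parent's value is a separate parameter so that the root, its own parent, is
-- included.
shape-on : ∀ H p e {P} → P ≡ H → common p e ≡ length p →
  Shape P (height H e p) (height H e (p ∷ʳ false)) (height H e (p ∷ʳ true))
shape-on H p e refl eq with common-full p e eq
... | r , refl
  rewrite height-on H (p ++ r) p eq | height-on-child H p false r | height-on-child H p true r =
  shape H r
  where
  shape : ∀ H r → Shape H H ((H + common (false ∷ []) r) ∸ 1) ((H + common (true ∷ []) r) ∸ 1)
  shape zero    []          = flat
  shape zero    (true ∷ r)  = flat
  shape zero    (false ∷ r) = flat
  shape (suc H) []          rewrite +-identityʳ H = tip H
  shape (suc H) (true ∷ r)  rewrite +-identityʳ H | +-comm H 1 = pathʳ H
  shape (suc H) (false ∷ r) rewrite +-identityʳ H | +-comm H 1 = pathˡ H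

-- In a tree, a descent that has left the path to `e` never rejoins it.
common-off : ∀ p r e → common p e < length p → common (p ++ r) e ≡ common p e
common-off p r e lt with ⊓-sel (length p) (common (p ++ r) e)
... | inj₁ eq = contradiction (trans (common-++ p r e) eq) (<⇒≢ lt)
... | inj₂ eq = sym (trans (common-++ p r e) eq)

-- Off the path the overlap with `e` is frozen while the depth grows, so parent, node and children
-- read Y, Y ∸ 1, Y ∸ 2, Y ∸ 2. Truncation at zero produces the `rim` and `flat` cases.
shape-off : ∀ H p b e → common (p ∷ʳ b) e < length (p ∷ʳ b) →
  Shape (height H e p) (height H e (p ∷ʳ b))
        (height H e ((p ∷ʳ b) ∷ʳ false)) (height H e ((p ∷ʳ b) ∷ʳ true))
shape-off H p b e lt
  rewrite common-off (p ∷ʳ b) (false ∷ []) e lt | common-off (p ∷ʳ b) (true ∷ []) e lt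
        | length-snoc (p ∷ʳ b) false | length-snoc (p ∷ʳ b) true
        | length-snoc p b
        | trans (common-++ p (b ∷ []) e) (m≥n⇒m⊓n≡n (s≤s⁻¹ lt)) =
  subst₂ (λ x y → Shape (X ∸ length p) x y y)
    (trans (∸-+-assoc X (length p) 1) (cong (X ∸_) (+-comm (length p) 1)))
    (trans (∸-+-assoc X (length p) 2) (cong (X ∸_) (+-comm (length p) 2)))
    (shape (X ∸ length p))
  where
  X = H + common (p ∷ʳ b) e
  shape : ∀ Y → Shape Y (Y ∸ 1) (Y ∸ 2) (Y ∸ 2)
  shape zero          = flat
  shape (suc zero)    = rim
  shape (suc (suc m)) = slope m

height-shape : ∀ H e v → 1 ≤ v → ShapeAt (λ w → height H e (path w)) v
height-shape H e v 1≤v rewrite path-child v false 1≤v | path-child v true 1≤v with nodeView v 1≤v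
... | root = shape-on H [] e (height-on H e [] refl) refl
... | childOf w b 1≤w rewrite parent-child w b 1≤w | path-child w b 1≤w
  with m≤n⇒m<n∨m≡n (common-≤ (path w ∷ʳ b) e)
...   | inj₁ off = shape-off H (path w) b e off
...   | inj₂ on  = shape-on H (path w ∷ʳ b) e (height-on H e (path w)
  (trans (common-++ (path w) (b ∷ []) e) (m≤n⇒m⊓n≡m
    (≤-trans (n≤1+n _) (≤-reflexive (sym (trans on (length-snoc (path w) b)))))))) on

-- suc (common _ _) is the level of the last common ancestor.
infix 4 _⊑_
_⊑_ : ∀ {n} → Elem n → Elem n → Set
x ⊑ y = level (i x) + j x ≤ j y + suc (common (path (i x)) (path (i y)))

-- Invariants of legal play, the total number of firings, and greedy play.

module Firing-dynamics (n : ℕ) (2≤n : 2 ≤ n) where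

  N : ℕ
  N = chips n

  f∞ : ℕ → ℕ
  f∞ v = F (n ∸ level v)

  -- Firing every node `f∞` times leaves exactly one chip on each node of the first n levels.
  f∞-balance : ∀ v → 1 ≤ v → level v ≤ n → N * ind 1 v + nbr f∞ v ≡ 3 * f∞ v + 1
  f∞-balance v 1≤v ℓ≤n with nodeView v 1≤v
  ... | root rewrite level-child 1 false ≤-refl | level-child 1 true ≤-refl =
    trans (lem₁ N (F (n ∸ 1)) (F (n ∸ 2)))
      (trans (cong (F (n ∸ 1) +_) (chips-root n 2≤n)) (lem₂ (F (n ∸ 1))))
    where
    lem₁ : ∀ N x y → N * 1 + (x + (y + y)) ≡ x + (N + 2 * y)
    lem₁ = solve-∀
    lem₂ : ∀ x → x + (2 * x + 1) ≡ 3 * x + 1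
    lem₂ = solve-∀
  ... | childOf w b 1≤w
    rewrite ind-≢ (<⇒≢ (child-pos w b 1≤w)) | *-zeroʳ N
          | parent-child w b 1≤w
          | level-child (child w b) false (<⇒≤ (child-pos w b 1≤w))
          | level-child (child w b) true (<⇒≤ (child-pos w b 1≤w))
          | level-child w b 1≤w
          | sym (pred[m∸n]≡m∸[1+n] n (suc (level w))) =
    trans (cong (λ z → F z + (F (pred (n ∸ suc (level w))) + F (pred (n ∸ suc (level w)))))
            (∸-suc ℓ≤n))
      (F-recurrence (n ∸ suc (level w)))
    where
    ∸-suc : ∀ {m k} → suc k ≤ m → m ∸ k ≡ suc (m ∸ suc k)
    ∸-suc {suc m} {k} (s≤s k≤m) = +-∸-assoc 1 k≤m

  f∞-deep : ∀ v → n ≤ level v → f∞ v ≡ 0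
  f∞-deep v n≤ℓ rewrite m≤n⇒m∸n≡0 n≤ℓ = refl

  f∞-deep-child : ∀ v b → 1 ≤ v → n ≤ level v → f∞ (child v b) ≡ 0
  f∞-deep-child v b 1≤v n≤ℓ =
    f∞-deep (child v b) (subst (n ≤_) (sym (level-child v b 1≤v)) (m≤n⇒m≤1+n n≤ℓ))

  -- Below level n the left side vanishes: neither the parent nor the children of such a node ever
  -- fire.
  f∞-balance-≤ : ∀ v → 1 ≤ v → N * ind 1 v + nbr f∞ v ≤ 3 * f∞ v + 1
  f∞-balance-≤ v 1≤v with level v ≤? n
  ... | yes ℓ≤n = ≤-reflexive (f∞-balance v 1≤v ℓ≤n)
  ... | no  ℓ≰n with nodeView v 1≤v
  ...   | root = contradiction (<⇒≤ 2≤n) ℓ≰n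
  ...   | childOf w b 1≤w
    rewrite ind-≢ (<⇒≢ (child-pos w b 1≤w)) | *-zeroʳ N
          | parent-child w b 1≤w
          | f∞-deep w (s≤s⁻¹ (subst (n <_) (level-child w b 1≤w) (≰⇒> ℓ≰n)))
          | f∞-deep-child (child w b) false (<⇒≤ (child-pos w b 1≤w)) (<⇒≤ (≰⇒> ℓ≰n))
          | f∞-deep-child (child w b) true (<⇒≤ (child-pos w b 1≤w)) (<⇒≤ (≰⇒> ℓ≰n)) = z≤n

  f∞-large : ∀ v → n ∸ level v ≤ f∞ v
  f∞-large v = k≤Fk (n ∸ level v)

  f∞-support : ∀ v → 1 ≤ v → 1 ≤ f∞ v → level v < n
  f∞-support v 1≤v pos with level v <? n
  ... | yes ℓ<n = ℓ<n
  ... | no  ℓ≮n = contradiction (subst (1 ≤_) (f∞-deep v (≮⇒≥ ℓ≮n)) pos) (λ ())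

  -- Confines all firings to finitely many nodes, so that maxima and sums over nodes make sense.
  f∞-range : ∀ v → 1 ≤ v → 1 ≤ f∞ v → v ≤ 2 ^ n
  f∞-range v 1≤v pos = ≤-trans (<⇒≤ (v<2^level v 1≤v))
    (^-monoʳ-≤ 2 (<⇒≤ (f∞-support v 1≤v pos)))

  -- What every legal start of play satisfies. `bounded` is the least action principle. `recency`
  -- holds because a neighbour that has fired since `v` last did has left a chip that `v` still
  -- holds.
  record State (past : List Firing) (pos : Config) : Set where
    field
      positive : ∀ k → 1 ≤ pos k
      balance  : ∀ v → 1 ≤ v → count pos v N + 3 * countNode v past
                               ≡ N * ind 1 v + nbr (λ w → countNode w past) v
      bounded  : ∀ v → 1 ≤ v → countNode v past ≤ f∞ v
      recency  : ∀ v → 1 ≤ v → nbr (λ w → recent past w v) v ≤ count pos v N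

  open State

  start : State [] initial
  start = record
    { positive = λ _ → ≤-refl
    ; balance  = λ v _ → cong (_+ 0) (count-initial v N)
    ; bounded  = λ _ _ → z≤n
    ; recency  = λ _ _ → z≤n
    }

  fire-positive : ∀ g pos → 1 ≤ node g → (∀ k → 1 ≤ pos k) → ∀ k → 1 ≤ fire g pos k
  fire-positive g pos 1≤x 1≤pos k with k ≟ lo g
  ... | yes _ = <⇒≤ (child-pos (node g) false 1≤x)
  ... | no _ with k ≟ mid g
  ...   | yes _ = parent-pos (node g) 1≤x
  ...   | no _ with k ≟ hi g
  ...     | yes _ = <⇒≤ (child-pos (node g) true 1≤x)
  ...     | no _  = 1≤pos k

  legal-count : ∀ {pos g} → LegalFiring N pos g → 3 ≤ count pos (node g) N
  legal-count {pos} {g} (1≤a , a<b , b<c , c≤N , pa , pb , pc) =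
    ≤-trans (s≤s (≤-trans (s≤s (≤-trans (s≤s z≤n) (count-suc pos (node g) {0} pa 1≤a)))
                          (count-suc pos (node g) pb a<b)))
      (≤-trans (count-suc pos (node g) pc b<c) (count-mono pos (node g) c≤N))

  step : ∀ {past pos g} → State past pos → LegalFiring N pos g → State (g ∷ past) (fire g pos)
  step {past} {pos} {g} st legal = record
    { positive = fire-positive g pos 1≤x (positive st)
    ; balance  = balance′
    ; bounded  = bounded′
    ; recency  = recency′
    }
    where
    x = node g
    1≤x : 1 ≤ x
    1≤x = subst (1 ≤_) (proj₁ (proj₂ (proj₂ (proj₂ (proj₂ legal))))) (positive st (lo g))
    q : ℕ → ℕ
    q v = countNode v past
    q′ : ℕ → ℕ
    q′ v = countNode v (g ∷ past)
    q′-split : ∀ v → q′ v ≡ ind x v + q v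
    q′-split v = countNode-∷ v g past
    cf : ∀ v → 1 ≤ v → count (fire g pos) v N + 3 * ind x v ≡ count pos v N + nbr (ind x) v
    cf v = count-fire v legal 1≤x
    balance′ : ∀ v → 1 ≤ v → count (fire g pos) v N + 3 * q′ v ≡ N * ind 1 v + nbr q′ v
    balance′ v 1≤v = begin
      count (fire g pos) v N + 3 * q′ v
        ≡⟨ cong (λ z → count (fire g pos) v N + 3 * z) (q′-split v) ⟩
      count (fire g pos) v N + 3 * (ind x v + q v)
        ≡⟨ s₁ (count (fire g pos) v N) (ind x v) (q v) ⟩
      count (fire g pos) v N + 3 * ind x v + 3 * q v
        ≡⟨ cong (_+ 3 * q v) (cf v 1≤v) ⟩
      count pos v N + nbr (ind x) v + 3 * q v
        ≡⟨ s₂ (count pos v N) (nbr (ind x) v) (3 * q v) ⟩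
      count pos v N + 3 * q v + nbr (ind x) v
        ≡⟨ cong (_+ nbr (ind x) v) (balance st v 1≤v) ⟩
      N * ind 1 v + nbr q v + nbr (ind x) v
        ≡⟨ s₃ (N * ind 1 v) (nbr q v) (nbr (ind x) v) ⟩
      N * ind 1 v + (nbr (ind x) v + nbr q v)
        ≡⟨ cong (N * ind 1 v +_) (sym (nbr-+ (ind x) q v)) ⟩
      N * ind 1 v + nbr (λ w → ind x w + q w) v
        ≡⟨ cong (N * ind 1 v +_) (nbr-cong v 1≤v (λ w _ → sym (q′-split w))) ⟩
      N * ind 1 v + nbr q′ v ∎
      where
      open ≡-Reasoning
      s₁ : ∀ a b c → a + 3 * (b + c) ≡ a + 3 * b + 3 * c
      s₁ = solve-∀
      s₂ : ∀ a b c → a + b + c ≡ a + c + b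
      s₂ = solve-∀
      s₃ : ∀ a b c → a + b + c ≡ a + (c + b)
      s₃ = solve-∀
    -- Least action: x cannot fire more often than f∞ x as long as its neighbours have not.
    bounded′ : ∀ v → 1 ≤ v → q′ v ≤ f∞ v
    bounded′ v 1≤v with x ≟ v
    ... | no  _    = bounded st v 1≤v
    ... | yes refl = s≤s⁻¹ (*-cancelˡ-< 3 _ _ (linear 1
      (legal-count {pos} legal ⊞ ≤-reflexive (balance st v 1≤v) ⊞ nbr-mono v 1≤v (bounded st)
        ⊞ f∞-balance-≤ v 1≤v)
      (lem (count pos v N) (q v) (N * ind 1 v) (nbr q v) (nbr f∞ v) (f∞ v))))
      where
      lem : ∀ c q i s t f → suc (3 * suc q) + (c + (i + s) + t + (3 * f + 1)) + 1
        ≡ 3 * suc f + (3 + (c + 3 * q) + s + (i + t))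
      lem = solve-∀
    r : ℕ → ℕ → ℕ
    r v w = recent past w v
    r′ : ℕ → ℕ → ℕ
    r′ v w = recent (g ∷ past) w v
    recency-other : ∀ v → 1 ≤ v → x ≢ v → nbr (r′ v) v ≤ count (fire g pos) v N
    recency-other v 1≤v x≢v = linear 0
      (nbr-mono {r′ v} v 1≤v (λ w _ → recent-other g past w v x≢v)
        ⊞ ≤-reflexive (nbr-+ (r v) (ind x) v)
        ⊞ recency st v 1≤v ⊞ ≤-reflexive (sym (cf v 1≤v))
        ⊞ ≤-reflexive (cong (3 *_) (ind-≢ x≢v)))
      (lem (nbr (r′ v) v) (nbr (λ w → r v w + ind x w) v) (nbr (r v) v)
        (nbr (ind x) v) (count pos v N) (count (fire g pos) v N) (ind x v))
      where
      lem : ∀ r r₁ r₂ i c c′ k → r + (r₁ + (r₂ + i) + c + (c′ + 3 * k) + 0) + 0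
        ≡ c′ + (r + r₁ + r₂ + (c + i) + 3 * k)
      lem = solve-∀
    -- Just after its firing only `v` itself is recent, so the claim concerns nothing but the chip
    -- returned by the loop.
    recency-own : ∀ v → 1 ≤ v → x ≡ v → nbr (r′ v) v ≤ count (fire g pos) v N
    recency-own v 1≤v x≡v = linear 0
      (≤-reflexive (nbr-cong {r′ v} v 1≤v (λ w _ → recent-own g past w v x≡v))
        ⊞ subst (λ y → 3 ≤ count pos y N) x≡v (legal-count {pos} legal)
        ⊞ ≤-reflexive (sym (cf v 1≤v))
        ⊞ ≤-reflexive (cong (3 *_) (trans (cong (ind x) (sym x≡v)) (ind-refl x))))
      (lem (nbr (r′ v) v) (nbr (ind x) v) (count pos v N) (count (fire g pos) v N) (ind x v))
      where
      lem : ∀ r i c c′ k → r + (i + c + (c′ + 3 * k) + 3) + 0 ≡ c′ + (r + 3 + (c + i) + 3 * k)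
      lem = solve-∀
    recency′ : ∀ v → 1 ≤ v → nbr (λ w → recent (g ∷ past) w v) v ≤ count (fire g pos) v N
    recency′ v 1≤v = [ recency-own v 1≤v , recency-other v 1≤v ]′ (toSum (x ≟ v))

  -- u is the number of firings still to come if the total is to be f∞.
  chips-left : ∀ {past pos} (u : ℕ → ℕ) → State past pos →
    (∀ w → 1 ≤ w → countNode w past + u w ≡ f∞ w) → ∀ v → 1 ≤ v → level v ≤ n →
    count pos v N + nbr u v ≡ 1 + 3 * u v
  chips-left {past} {pos} u st total v 1≤v ℓ≤n = +-cancelʳ-≡ (3 * q v) _ _ (begin
    count pos v N + nbr u v + 3 * q v    ≡⟨ s₁ (count pos v N) (nbr u v) (3 * q v) ⟩
    count pos v N + 3 * q v + nbr u v    ≡⟨ cong (_+ nbr u v) (balance st v 1≤v) ⟩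
    N * ind 1 v + nbr q v + nbr u v      ≡⟨ +-assoc (N * ind 1 v) (nbr q v) (nbr u v) ⟩
    N * ind 1 v + (nbr q v + nbr u v)    ≡⟨ cong (N * ind 1 v +_) (sym (nbr-+ q u v)) ⟩
    N * ind 1 v + nbr (λ w → q w + u w) v
      ≡⟨ cong (N * ind 1 v +_) (nbr-cong v 1≤v total) ⟩
    N * ind 1 v + nbr f∞ v               ≡⟨ f∞-balance v 1≤v ℓ≤n ⟩
    3 * f∞ v + 1                         ≡⟨ cong (λ z → 3 * z + 1) (sym (total v 1≤v)) ⟩
    3 * (q v + u v) + 1                  ≡⟨ s₂ (q v) (u v) ⟩
    1 + 3 * u v + 3 * q v                ∎)
    where
    open ≡-Reasoning
    q : ℕ → ℕ
    q w = countNode w past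
    s₁ : ∀ a b c → a + b + c ≡ a + c + b
    s₁ = solve-∀
    s₂ : ∀ a b → 3 * (a + b) + 1 ≡ 1 + 3 * b + 3 * a
    s₂ = solve-∀

  -- The node maximising (d, h, label) lexicographically has at least three chips.
  fireable : ∀ {past pos} (h d : ℕ → ℕ) K → State past pos →
    (∀ v → 1 ≤ v → ShapeAt h v) → (∀ v → 1 ≤ v → h v < K) →
    (∀ v → 1 ≤ v → countNode v past + (h v + d v) ≡ f∞ v) →
    ∀ v₀ → 1 ≤ v₀ → 1 ≤ d v₀ → ∃[ v ] 1 ≤ v × 1 ≤ d v × 3 ≤ count pos v N
  fireable {past} {pos} h d K st shape h<K total v₀ 1≤v₀ 1≤d₀
    with last-argmax (λ w → d w * K + h w) (pred (2 ^ n))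
  ... | v , 1≤v , v≤M , max , last = v , 1≤v , 1≤d ,
    shape-fires (count pos v N) (d (parent v)) (d v) (d (2 * v)) (d (2 * v + 1)) (shape v 1≤v)
      (d≤ _ (parent-pos v 1≤v)) (d≤ _ (1≤c false)) (d≤ _ (1≤c true))
      (d<-h (parent v) (parent-pos v 1≤v))
      (d<-label _ (child-> v false 1≤v)) (d<-label _ (child-> v true 1≤v))
      (chips-left (λ w → h w + d w) st total v 1≤v (<⇒≤ (f∞-support v 1≤v (d⇒f v 1≤v 1≤d))))
    where
    open Lex K
    1≤c : ∀ b → 1 ≤ child v b
    1≤c b = <⇒≤ (child-pos v b 1≤v)
    d⇒f : ∀ w → 1 ≤ w → 1 ≤ d w → 1 ≤ f∞ w
    d⇒f w 1≤w 1≤d = ≤-trans 1≤d (subst (d w ≤_) (total w 1≤w)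
      (≤-trans (m≤n+m (d w) (h w)) (m≤n+m _ (countNode w past))))
    in-range : ∀ w → 1 ≤ w → 1 ≤ d w → w ≤ suc (pred (2 ^ n))
    in-range w 1≤w 1≤d = ≤-trans (f∞-range w 1≤w (d⇒f w 1≤w 1≤d))
      (≤-reflexive (sym (suc-pred (2 ^ n) {{m^n≢0 2 n}})))
    d≤ : ∀ w → 1 ≤ w → d w ≤ d v
    d≤ w 1≤w with d w in eq
    ... | zero  = z≤n
    ... | suc k = subst (_≤ d v) eq (lex-≤ {d v} {d w} (h<K v 1≤v)
                    (max w 1≤w (in-range w 1≤w (subst (1 ≤_) (sym eq) (s≤s z≤n)))))
    1≤d : 1 ≤ d v
    1≤d = ≤-trans 1≤d₀ (d≤ v₀ 1≤v₀)
    -- A node with `d w` equal to zero may lie outside the searched range; positivity of `d v`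
    -- settles that case.
    d<-h : ∀ w → 1 ≤ w → h v < h w → d w < d v
    d<-h w 1≤w h<h with d w in eq
    ... | zero  = 1≤d
    ... | suc k = subst (_< d v) eq (lex-<′ {d v} {d w} (h<K v 1≤v) h<h
                    (max w 1≤w (in-range w 1≤w (subst (1 ≤_) (sym eq) (s≤s z≤n)))))
    d<-label : ∀ w → v < w → h v ≤ h w → d w < d v
    d<-label w v<w h≤h with d w in eq
    ... | zero  = 1≤d
    ... | suc k = subst (_< d v) eq (lex-< {d v} {d w} (h<K v 1≤v) h≤h
                    (last w v<w (in-range w (≤-trans 1≤v (<⇒≤ v<w))
                      (subst (1 ≤_) (sym eq) (s≤s z≤n)))))

  run-state : ∀ {past pos} fs → State past pos → Legal N pos fs → State (fs ʳ++ past) (run pos fs)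
  run-state []       st []            = st
  run-state (f ∷ fs) st (legal ∷ rest) = run-state fs (step st legal) rest

  countNode-ʳ++ : ∀ v fs past → countNode v (fs ʳ++ past) ≡ countNode v past + countNode v fs
  countNode-ʳ++ v []       past = sym (+-identityʳ _)
  countNode-ʳ++ v (f ∷ fs) past = trans (countNode-ʳ++ v fs (f ∷ past)) (swap-∷ v f fs past)
    where
    swap-∷ : ∀ v f fs past →
      countNode v (f ∷ past) + countNode v fs ≡ countNode v past + countNode v (f ∷ fs)
    swap-∷ v f fs past rewrite countNode-∷ v f past | countNode-∷ v f fs =
      lem (ind (node f) v) (countNode v past) (countNode v fs)
      where
      lem : ∀ a b c → a + b + c ≡ b + (a + c)
      lem = solve-∀

  -- Greedy play towards the remainder `h`: the target stays fixed, and the sum of `d`, the moves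
  -- still to be played before it, drops by one with each firing that `fireable` offers.
  reach : ∀ (h : ℕ → ℕ) K → (∀ v → 1 ≤ v → ShapeAt h v) → (∀ v → 1 ≤ v → h v < K) →
    ∀ k {past pos} (d : ℕ → ℕ) → State past pos →
    (∀ v → 1 ≤ v → countNode v past + (h v + d v) ≡ f∞ v) → sumTo d (2 ^ n) ≡ k →
    ∃[ fs ] Legal N pos fs × (∀ v → 1 ≤ v → countNode v past + countNode v fs + h v ≡ f∞ v)
  reach h K shape h<K zero {past} {pos} d st total sum≡0 = [] , [] , done
    where
    d≡0 : ∀ v → 1 ≤ v → d v ≡ 0
    d≡0 v 1≤v with d v in eq
    ... | zero  = refl
    ... | suc k = trans (sym eq) (n≤0⇒n≡0 (subst (d v ≤_) sum≡0
      (≤-sumTo d v (2 ^ n) 1≤v (f∞-range v 1≤v (≤-trans (subst (1 ≤_) (sym eq) (s≤s z≤n))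
        (subst (d v ≤_) (total v 1≤v) (≤-trans (m≤n+m (d v) (h v)) (m≤n+m _ (countNode v past)))))))))
    done : ∀ v → 1 ≤ v → countNode v past + 0 + h v ≡ f∞ v
    done v 1≤v = trans (cong₂ _+_ (+-identityʳ _) (trans (sym (+-identityʳ _))
      (cong (h v +_) (sym (d≡0 v 1≤v))))) (total v 1≤v)
  reach h K shape h<K (suc k) {past} {pos} d st total sum≡
    with sumTo-pos d (2 ^ n) (subst (1 ≤_) (sym sum≡) (s≤s z≤n))
  ... | v₀ , 1≤v₀ , v₀≤M , 1≤d₀ with fireable h d K st shape h<K total v₀ 1≤v₀ 1≤d₀
  ...   | v , 1≤v , 1≤d , 3≤c with three-chips pos v N 3≤c
  ...     | a , b , c , 1≤a , a<b , b<c , c≤N , pa , pb , pc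
    with reach h K shape h<K k d′ (step st legal) total′ sum≡′
    where
    g = firing v a b c
    legal : LegalFiring N pos g
    legal = 1≤a , a<b , b<c , c≤N , pa , pb , pc
    d′ : ℕ → ℕ
    d′ w = d w ∸ ind v w
    d-split : ∀ w → d w ≡ ind v w + d′ w
    d-split w with v ≟ w
    ... | yes refl rewrite ind-refl v = sym (m+[n∸m]≡n 1≤d)
    ... | no  v≢w  rewrite ind-≢ v≢w  = refl
    total′ : ∀ w → 1 ≤ w → countNode w (g ∷ past) + (h w + d′ w) ≡ f∞ w
    total′ w 1≤w = trans (cong (_+ (h w + d′ w)) (countNode-∷ w g past))
      (trans (lem (ind v w) (countNode w past) (h w) (d′ w))
        (trans (cong (λ z → countNode w past + (h w + z)) (sym (d-split w))) (total w 1≤w)))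
      where
      lem : ∀ i q h d → i + q + (h + d) ≡ q + (h + (i + d))
      lem = solve-∀
    sum-ind : ∀ m → v ≤ m → sumTo (ind v) m ≡ 1
    sum-below : ∀ m → m < v → sumTo (ind v) m ≡ 0
    sum-below zero    _   = refl
    sum-below (suc m) m<v rewrite ind-≢ (≢-sym (<⇒≢ m<v)) = sum-below m (<⇒≤ m<v)
    sum-ind zero v≤0 = contradiction (≤-trans 1≤v v≤0) (λ ())
    sum-ind (suc m) v≤ with m≤n⇒m<n∨m≡n v≤
    ... | inj₂ refl rewrite ind-refl m | sum-below m ≤-refl = refl
    ... | inj₁ v<sm rewrite ind-≢ (<⇒≢ v<sm) = sum-ind m (s≤s⁻¹ v<sm)
    sum≡′ : sumTo d′ (2 ^ n) ≡ k
    sum≡′ = suc-injective (trans (cong (_+ sumTo d′ (2 ^ n))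
        (sym (sum-ind (2 ^ n) (f∞-range v 1≤v (≤-trans 1≤d
          (subst (d v ≤_) (total v 1≤v) (≤-trans (m≤n+m (d v) (h v)) (m≤n+m _ (countNode v past)))))))))
      (trans (sym (sumTo-+ (ind v) d′ (2 ^ n)))
        (trans (sumTo-cong (2 ^ n) (λ w → sym (d-split w))) sum≡)))
  ...       | fs , legals , total″ = firing v a b c ∷ fs ,
    (1≤a , a<b , b<c , c≤N , pa , pb , pc) ∷ legals ,
    (λ w 1≤w → trans (cong (_+ h w) (trans (cong (countNode w past +_)
                  (countNode-∷ w (firing v a b c) fs))
                 (trans (lem (countNode w past) (ind v w) (countNode w fs))
                   (cong (_+ countNode w fs) (sym (countNode-∷ w (firing v a b c) past))))))
               (total″ w 1≤w))
    where
    lem : ∀ a b c → a + (b + c) ≡ b + a + c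
    lem = solve-∀

  flat-shape : ∀ v → 1 ≤ v → ShapeAt (λ _ → 0) v
  flat-shape _ _ = flat

  stable-no-three : ∀ {pos} → Stable N pos → ∀ v → ¬ 3 ≤ count pos v N
  stable-no-three {pos} stable v 3≤c =
    let a , b , c , 1≤a , a<b , b<c , c≤N , pa , pb , pc = three-chips pos v N 3≤c
    in stable a b c 1≤a a<b b<c c≤N (trans pa (sym pb)) (trans pb (sym pc))

  -- With target zero, `fireable` says that play short of `f∞` can always continue. Together with
  -- `bounded` this fixes the firing counts of every complete sequence.
  unfinished-unstable : ∀ {past pos} → State past pos → Stable N pos →
    ∀ v → 1 ≤ v → ¬ countNode v past < f∞ v
  unfinished-unstable {past} {pos} st stable v 1≤v q<f =
    let w , _ , _ , 3≤c = fireable (λ _ → 0) (λ w → f∞ w ∸ countNode w past) 1 st flat-shape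
          (λ _ _ → s≤s z≤n) (λ w 1≤w → m+[n∸m]≡n (bounded st w 1≤w)) v 1≤v (m<n⇒0<n∸m q<f)
    in stable-no-three stable w 3≤c

  stable-total : ∀ {past pos} → State past pos → Stable N pos → ∀ v → 1 ≤ v → countNode v past ≡ f∞ v
  stable-total st stable v 1≤v =
    [ ⊥-elim ∘ unfinished-unstable st stable v 1≤v , (λ eq → eq) ]′
      (m≤n⇒m<n∨m≡n (bounded st v 1≤v))

  complete-total : ∀ {past pos} fs → State past pos → Legal N pos fs → Stable N (run pos fs) →
    ∀ v → 1 ≤ v → countNode v past + countNode v fs ≡ f∞ v
  complete-total {past} fs st legal stable v 1≤v = trans (sym (countNode-ʳ++ v fs past))
    (stable-total (run-state fs st legal) stable v 1≤v)

  -- When all firings are spent, the balance leaves at most one chip on any node.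
  total-stable : ∀ {past pos} → State past pos → (∀ v → 1 ≤ v → countNode v past ≡ f∞ v) →
    Stable N pos
  total-stable {past} {pos} st total a b c 1≤a a<b b<c c≤N pa≡pb _ =
    contradiction (two-chips pos N 1≤a a<b (≤-trans (<⇒≤ b<c) c≤N) pa≡pb)
      (<⇒≱ (s≤s count≤1))
    where
    v = pos a
    1≤v : 1 ≤ v
    1≤v = positive st a
    count≤1 : count pos v N ≤ 1
    count≤1 = linear 0 (≤-reflexive (balance st v 1≤v) ⊞ f∞-balance-≤ v 1≤v
        ⊞ ≤-reflexive (nbr-cong v 1≤v total) ⊞ ≤-reflexive (cong (3 *_) (sym (total v 1≤v))))
      (lem (count pos v N) (3 * countNode v past) (N * ind 1 v)
        (nbr (λ w → countNode w past) v) (nbr f∞ v) (3 * f∞ v))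
      where
      lem : ∀ c q i s t f → c + (i + s + (f + 1) + t + q) + 0 ≡ 1 + (c + q + (i + t) + s + f)
      lem = solve-∀

  -- Alternation of parents and children in the endgame.

  -- A node c and its parent p alternate, p firing last; the premise says that (c , u c) is an
  -- endgame move.
  Alternating : List Firing → (ℕ → ℕ) → ℕ → Bool → Set
  Alternating past u p b = let c = child p b in
    u c + suc (level p) < n → u c + recent past c p ≡ u p

  module Snapshot {past pos} (u : ℕ → ℕ) (st : State past pos)
                  (total : ∀ w → 1 ≤ w → countNode w past + u w ≡ f∞ w) where

    -- The recent neighbours are at most the chips on `v`, and `chips-left` expresses these through
    -- `u`. All uses of this bound fix two neighbours from below to bound the third from above.
    crowding : ∀ v → 1 ≤ v → level v ≤ n → nbr u v + nbr (λ w → recent past w v) v ≤ 1 + 3 * u v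
    crowding v 1≤v ℓ≤n = linear 0 (recency st v 1≤v ⊞ ≤-reflexive (chips-left u st total v 1≤v ℓ≤n))
      (lem (nbr u v) (nbr (λ w → recent past w v) v) (count pos v N) (1 + 3 * u v))
      where
      lem : ∀ a r c t → a + r + (c + t) + 0 ≡ t + (r + (c + a))
      lem = solve-∀

    -- In all `v` fires at least n - level v times, and fewer than that many are left.
    fired : ∀ v → 1 ≤ v → u v + level v < n → 1 ≤ countNode v past
    fired v 1≤v lt = +-cancelʳ-≤ (u v) 1 (countNode v past)
      (≤-trans (m+n≤o⇒m≤o∸n (suc (u v)) lt)
        (≤-trans (f∞-large v) (≤-reflexive (sym (total v 1≤v)))))

    child-bound : ∀ p b → Alternating past u p b → u p + suc (level p) ≤ n →
      u p ≤ u (child p b) + recent past (child p b) p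
    child-bound p b alt le with u (child p b) + suc (level p) <? n
    ... | yes lt = ≤-reflexive (sym (alt lt))
    ... | no  ≮  = ≤-trans (+-cancelʳ-≤ (suc (level p)) _ _ (≤-trans le (≮⇒≥ ≮))) (m≤m+n _ _)

    -- Alternation seen from the child: of two nodes exactly one is recent for the other, so the
    -- indicator turns into its complement. At the root the loop supplies the extra one.
    parent-bound : ∀ v → 1 ≤ v → (∀ p b → 1 ≤ p → v ≡ child p b → Alternating past u p b) →
      u v + level v < n → u (parent v) + recent past (parent v) v ≡ suc (u v)
    parent-bound v 1≤v alt lt with nodeView v 1≤v
    ... | root = trans (cong (u 1 +_) (recent-self past 1 (fired 1 1≤v lt))) (+-comm (u 1) 1)
    ... | childOf p b 1≤p rewrite parent-child p b 1≤p = begin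
      u p + recent past p c
        ≡⟨ cong (_+ recent past p c)
             (sym (alt p b 1≤p refl (subst (λ ℓ → u c + ℓ < n) (level-child p b 1≤p) lt))) ⟩
      u c + recent past c p + recent past p c
        ≡⟨ lem (u c) (recent past c p) (recent past p c) ⟩
      u c + (recent past p c + recent past c p)
        ≡⟨ cong (u c +_) (recent-pair past p c (<⇒≢ (child-> p b 1≤p)) (fired c 1≤v lt)) ⟩
      u c + 1
        ≡⟨ +-comm (u c) 1 ⟩
      suc (u c) ∎
      where
      open ≡-Reasoning
      c = child p b
      lem : ∀ a x y → a + x + y ≡ a + (y + x)
      lem = solve-∀

    -- Of the total 1 + 3u(p) the parent takes u(p) + 1 and the sibling at least u(p).
    down : ∀ p b → 1 ≤ p → level p ≤ n → u (parent p) + recent past (parent p) p ≡ suc (u p) →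
      u p ≤ u (child p (not b)) + recent past (child p (not b)) p →
      u (child p b) + recent past (child p b) p ≤ u p
    down p b 1≤p ℓ≤n up sib = linear 0
      (≤-reflexive (sym (cong₂ _+_ (nbr-child u p b) (nbr-child (λ w → recent past w p) p b)))
        ⊞ crowding p 1≤p ℓ≤n ⊞ ≤-reflexive (sym up) ⊞ sib)
      (lem (u (parent p)) (u (child p b)) (u (child p (not b)))
        (recent past (parent p) p) (recent past (child p b) p) (recent past (child p (not b)) p)
        (u p) (nbr u p + nbr (λ w → recent past w p) p))
      where
      lem : ∀ a b c r s t v S → b + s + (S + (1 + 3 * v) + (a + r) + (c + t)) + 0
        ≡ v + (a + (b + c) + (r + (s + t)) + S + suc v + v)
      lem = solve-∀

    -- Of the total 1 + 3u(c) the two children take at least u(c) each.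
    up : ∀ c → 1 ≤ c → level c ≤ n →
      (∀ b → u c ≤ u (child c b) + recent past (child c b) c) →
      u (parent c) + recent past (parent c) c ≤ suc (u c)
    up c 1≤c ℓ≤n kids = linear 0 (crowding c 1≤c ℓ≤n ⊞ kids false ⊞ kids true)
      (lem (u (parent c)) (u (2 * c)) (u (2 * c + 1))
        (recent past (parent c) c) (recent past (2 * c) c) (recent past (2 * c + 1) c) (u c))
      where
      lem : ∀ a b c r s t v → a + r + (1 + 3 * v + (b + s) + (c + t)) + 0
        ≡ suc v + (a + (b + c) + (r + (s + t)) + v + v)
      lem = solve-∀

  -- Backward step: alternation after the firing `g` is carried to the moment before it. Pairs that
  -- avoid `node g` are unchanged, and they feed the bounds for the pairs that contain it.
  module Unfire {past pos} g fs (st : State past pos)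
                (total : ∀ w → 1 ≤ w → countNode w past + countNode w (g ∷ fs) ≡ f∞ w)
                (next : ∀ p b → 1 ≤ p → Alternating (g ∷ past) (λ v → countNode v fs) p b) where
    u : ℕ → ℕ
    u v = countNode v (g ∷ fs)

    open Snapshot u st total

    transfer : ∀ p b → 1 ≤ p → node g ≢ p → node g ≢ child p b → Alternating past u p b
    transfer p b 1≤p x≢p x≢c lt
      rewrite countNode-skip p g fs x≢p | countNode-skip (child p b) g fs x≢c =
      trans (cong (countNode (child p b) fs +_) (sym (recent-skip g past (child p b) p x≢c x≢p)))
        (next p b 1≤p lt)

    -- After `g` the child is recent, which gives `u c ≡ u p` before it. What remains is that the
    -- child was not yet recent then, and crowding at `p` leaves no room for that.
    child-fired : ∀ p b → 1 ≤ p → node g ≡ child p b → Alternating past u p b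
    child-fired p b 1≤p x≡c lt = ≤-antisym uc+r≤up (≤-trans (≤-reflexive (sym uc≡up)) (m≤m+n _ _))
      where
      c = child p b
      p<c : p < c
      p<c = child-> p b 1≤p
      x≢ : ∀ {v} → v < c → node g ≢ v
      x≢ v<c x≡v = <⇒≢ v<c (trans (sym x≡v) x≡c)
      uc≡up : u c ≡ u p
      uc≡up = begin
        u c                                        ≡⟨ countNode-hit c g fs x≡c ⟩
        suc (countNode c fs)                       ≡⟨ +-comm 1 (countNode c fs) ⟩
        countNode c fs + 1
          ≡⟨ cong (countNode c fs +_) (sym (recent-hit g past c p x≡c)) ⟩
        countNode c fs + recent (g ∷ past) c p
          ≡⟨ next p b 1≤p (<⇒≤ (subst (λ z → z + suc (level p) < n) (countNode-hit c g fs x≡c) lt)) ⟩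
        countNode p fs                             ≡⟨ sym (countNode-skip p g fs (x≢ p<c)) ⟩
        u p                                        ∎
        where open ≡-Reasoning
      lt-p : u p + suc (level p) < n
      lt-p = subst (λ z → z + suc (level p) < n) uc≡up lt
      lt-p′ : u p + level p < n
      lt-p′ = ≤-trans (s≤s (+-monoʳ-≤ (u p) (n≤1+n (level p)))) lt-p
      uc+r≤up : u c + recent past c p ≤ u p
      uc+r≤up = down p b 1≤p (≤-trans (m≤n+m _ (u p)) (<⇒≤ lt-p′))
        (parent-bound p 1≤p
          (λ { p′ b′ 1≤p′ refl → transfer p′ b′ 1≤p′
                 (x≢ (<-trans (child-> p′ b′ 1≤p′) p<c)) (x≢ p<c) })
          lt-p′)
        (child-bound p (not b)
          (transfer p (not b) 1≤p (x≢ p<c) (λ x≡s → child-≢-sibling p b (trans (sym x≡c) x≡s)))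
          (<⇒≤ lt-p))

    -- After `g` the child is not recent, which gives `u p ≡ suc (u c)` before it. Crowding at the
    -- child then forbids `p` to be recent for `c`, so `c` has fired more recently.
    parent-fired : ∀ p b → 1 ≤ p → node g ≡ p → Alternating past u p b
    parent-fired p b 1≤p x≡p lt = trans (cong (u c +_) rc≡1) (trans (+-comm (u c) 1) (sym up≡))
      where
      c = child p b
      1≤c : 1 ≤ c
      1≤c = <⇒≤ (child-pos p b 1≤p)
      p<c : p < c
      p<c = child-> p b 1≤p
      x≢ : ∀ {v} → p < v → node g ≢ v
      x≢ p<v x≡v = <⇒≢ p<v (trans (sym x≡p) x≡v)
      up≡ : u p ≡ suc (u c)
      up≡ = begin
        u p                                          ≡⟨ countNode-hit p g fs x≡p ⟩
        suc (countNode p fs)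
          ≡⟨ cong suc (sym (next p b 1≤p
               (subst (λ z → z + suc (level p) < n) (countNode-skip c g fs (x≢ p<c)) lt))) ⟩
        suc (countNode c fs + recent (g ∷ past) c p)
          ≡⟨ cong (λ z → suc (countNode c fs + z))
               (trans (recent-own g past c p x≡p) (ind-≢ (x≢ p<c))) ⟩
        suc (countNode c fs + 0)                     ≡⟨ cong suc (+-identityʳ _) ⟩
        suc (countNode c fs)                         ≡⟨ cong suc (sym (countNode-skip c g fs (x≢ p<c))) ⟩
        suc (u c)                                    ∎
        where open ≡-Reasoning
      lt-c : u c + level c < n
      lt-c = subst (λ ℓ → u c + ℓ < n) (sym (level-child p b 1≤p)) lt
      up+r≤ : u p + recent past p c ≤ suc (u c)
      up+r≤ = subst (λ z → u z + recent past z c ≤ suc (u c)) (parent-child p b 1≤p)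
        (up c 1≤c (≤-trans (m≤n+m _ (u c)) (<⇒≤ lt-c))
          (λ b′ → child-bound c b′
            (transfer c b′ 1≤c (x≢ p<c) (x≢ (<-trans p<c (child-> c b′ 1≤c))))
            (subst (_≤ n) (sym (+-suc (u c) (level c))) lt-c)))
      rp≡0 : recent past p c ≡ 0
      rp≡0 = n≤0⇒n≡0 (+-cancelˡ-≤ (u p) _ _
        (≤-trans up+r≤ (≤-trans (≤-reflexive (sym up≡)) (m≤m+n (u p) 0))))
      rc≡1 : recent past c p ≡ 1
      rc≡1 = trans (cong (_+ recent past c p) (sym rp≡0))
        (recent-pair past p c (<⇒≢ p<c) (fired c 1≤c lt-c))

    unfire : ∀ p b → 1 ≤ p → Alternating past u p b
    unfire p b 1≤p =
      [ child-fired p b 1≤p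
      , (λ x≢c → [ parent-fired p b 1≤p
                 , (λ x≢p → transfer p b 1≤p x≢p x≢c) ]′ (toSum (node g ≟ p)))
      ]′ (toSum (node g ≟ child p b))

  -- Backward induction from the stable end. There the claim is that `p` has fired after its child;
  -- it is proved from the root downwards, since `down` at `p` relies on the pair above `p`.
  alternating : ∀ fs {past pos} → State past pos → Legal N pos fs → Stable N (run pos fs) →
    ∀ p b → 1 ≤ p → Alternating past (λ v → countNode v fs) p b
  alternating [] {past} {pos} st [] stable p b 1≤p = go p b 1≤p (<-wellFounded p)
    where
    open Snapshot (λ _ → 0) st (complete-total [] st [] stable)
    go : ∀ p b → 1 ≤ p → Acc _<_ p → Alternating past (λ _ → 0) p b
    go p b 1≤p (acc rs) lt = n≤0⇒n≡0 (down p b 1≤p (<⇒≤ (<⇒≤ lt))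
      (parent-bound p 1≤p (λ { p′ b′ 1≤p′ refl → go p′ b′ 1≤p′ (rs (child-> p′ b′ 1≤p′)) }) (<⇒≤ lt))
      z≤n)
  alternating (g ∷ fs) st (legal ∷ legals) stable =
    Unfire.unfire g fs st (complete-total (g ∷ fs) st (legal ∷ legals) stable)
      (alternating fs (step st legal) legals stable)

  -- From alternation to the order of moves, and back by greedy play.

  module Endgame fs {past pos} (st : State past pos) (legal : Legal N pos fs)
                 (stable : Stable N (run pos fs)) where
    u : ℕ → ℕ
    u v = countNode v fs

    open Snapshot u st (complete-total fs st legal stable)

    alt : ∀ p b → 1 ≤ p → Alternating past u p b
    alt = alternating fs st legal stable

    climb : ∀ p b → 1 ≤ p → u (child p b) + suc (level p) < n → u p ≤ suc (u (child p b))
    climb p b 1≤p lt = ≤-trans (m≤m+n (u p) _) (≤-reflexive (subst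
      (λ z → u z + recent past z c ≡ suc (u c)) (parent-child p b 1≤p)
      (parent-bound c (<⇒≤ (child-pos p b 1≤p)) (λ p′ b′ 1≤p′ _ → alt p′ b′ 1≤p′)
        (subst (λ ℓ → u c + ℓ < n) (sym (level-child p b 1≤p)) lt))))
      where c = child p b

    descend : ∀ p b → 1 ≤ p → u p + suc (level p) < n → u (child p b) ≤ u p
    descend p b 1≤p lt = ≤-trans (m≤m+n _ _) (down p b 1≤p
      (≤-trans (m≤n+m _ (u p)) (<⇒≤ lt′))
      (parent-bound p 1≤p (λ p′ b′ 1≤p′ _ → alt p′ b′ 1≤p′) lt′)
      (child-bound p (not b) (alt p (not b) 1≤p) (<⇒≤ lt)))
      where
      lt′ : u p + level p < n
      lt′ = ≤-trans (s≤s (+-monoʳ-≤ (u p) (n≤1+n (level p)))) lt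

  suffix-state : ∀ pre {post past pos} → State past pos → Legal N pos (pre ++ post) →
    Stable N (run pos (pre ++ post)) →
    ∃[ past′ ] ∃[ pos′ ] State past′ pos′ × Legal N pos′ post × Stable N (run pos′ post)
  suffix-state []        {past = past} {pos} st legal stable = past , pos , st , legal , stable
  suffix-state (f ∷ pre) st (l ∷ legal) stable = suffix-state pre (step st l) legal stable

  module Walk fs {past pos} (st : State past pos) (legal : Legal N pos fs)
              (stable : Stable N (run pos fs)) where
    open Endgame fs st legal stable

    walk-up : ∀ a s → 1 ≤ a → u (nodeFrom a s) + (level a + length s) < n →
      u a ≤ u (nodeFrom a s) + length s
    walk-up a []      1≤a lt = m≤m+n _ 0
    walk-up a (b ∷ s) 1≤a lt = ≤-trans (climb a b 1≤a (≤-trans (s≤s (+-monoˡ-≤ _ ih))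
        (≤-trans (≤-reflexive (lem (u e) (length s) (level a))) lt)))
      (≤-trans (s≤s ih) (≤-reflexive (sym (+-suc (u e) (length s)))))
      where
      e = nodeFrom (child a b) s
      ih : u (child a b) ≤ u e + length s
      ih = walk-up (child a b) s (<⇒≤ (child-pos a b 1≤a))
        (subst (λ z → u e + z < n) (trans (+-suc (level a) (length s))
          (cong (_+ length s) (sym (level-child a b 1≤a)))) lt)
      lem : ∀ a b c → suc (a + b + suc c) ≡ suc (a + (c + suc b))
      lem = solve-∀

    walk-down : ∀ a s m → 1 ≤ a → u a ≤ m → m + (level a + length s) < n → u (nodeFrom a s) ≤ m
    walk-down a []      m 1≤a le lt = le
    walk-down a (b ∷ s) m 1≤a le lt = walk-down (child a b) s m (<⇒≤ (child-pos a b 1≤a))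
      (≤-trans (descend a b 1≤a (≤-trans (s≤s (le ⊞ ≤-trans (s≤s (m≤m+n (level a) (length s)))
        (≤-reflexive (sym (+-suc (level a) (length s)))))) lt)) le)
      (subst (λ z → m + z < n) (trans (+-suc (level a) (length s))
          (cong (_+ length s) (sym (level-child a b 1≤a)))) lt)

  -- Suppose the move `x` came before `y`. Just after `x`, node `i x` has `j x` firings left and
  -- `i y` more than `j y`. Climbing to the last common ancestor adds at most one firing per level,
  -- and descending adds none, so `i y` has at most `j y` left.
  ⊑⇒≤P : ∀ {x y : Elem n} → x ⊑ y → x ≤P y
  ⊑⇒≤P {x} {y} x⊑y fs (legal , stable) t₁ t₂
    (pre₁ , f₁ , post₁ , fs≡₁ , refl , f₁≡ , cnt₁) (pre₂ , f₂ , post₂ , fs≡₂ , refl , f₂≡ , cnt₂)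
    = ≮⇒≥ absurd
    where
    absurd : ¬ length pre₂ < length pre₁
    absurd lt with later-suffix pre₂ pre₁ (trans (sym fs≡₂) fs≡₁) lt
    ... | mid′ , post₂≡ with suffix-state (pre₂ ∷ʳ f₂) start
                              (subst (Legal N initial) fs≡ legal)
                              (subst (λ z → Stable N (run initial z)) fs≡ stable)
      where
      fs≡ : fs ≡ (pre₂ ∷ʳ f₂) ++ post₂
      fs≡ = trans fs≡₂ (sym (++-assoc pre₂ (f₂ ∷ []) post₂))
    ...   | past , pos , st , legal′ , stable′ with common-split (path (i x)) (path (i y))
    ...     | c , s , t , px≡ , py≡ , len≡ = contradiction u-y (<⇒≱ u-y>)
      where
      open Endgame post₂ st legal′ stable′
      open Walk post₂ st legal′ stable′
      a = nodeFrom 1 c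
      1≤a : 1 ≤ a
      1≤a = nodeFrom-pos 1 c ≤-refl
      x≡ : nodeFrom a s ≡ i x
      x≡ = trans (sym (nodeFrom-++ 1 c s))
        (trans (cong (nodeFrom 1) (sym px≡)) (node-path (i x) (i-pos x)))
      y≡ : nodeFrom a t ≡ i y
      y≡ = trans (sym (nodeFrom-++ 1 c t))
        (trans (cong (nodeFrom 1) (sym py≡)) (node-path (i y) (i-pos y)))
      level-a : level a ≡ suc (common (path (i x)) (path (i y)))
      level-a = trans (level-nodeFrom 1 c ≤-refl) (cong suc len≡)
      level-x : level (i x) ≡ level a + length s
      level-x = trans (cong level (sym x≡)) (level-nodeFrom a s 1≤a)
      level-y : level (i y) ≡ level a + length t
      level-y = trans (cong level (sym y≡)) (level-nodeFrom a t 1≤a)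
      u-x : u (nodeFrom a s) ≡ j x
      u-x = trans (cong u x≡) cnt₂
      u-y> : j y < u (nodeFrom a t)
      u-y> = subst₂ _≤_ (cong suc cnt₁) (trans (sym eq) (cong u (sym y≡))) (m≤n+m _ (countNode (i y) mid′))
        where
        eq : u (i y) ≡ countNode (i y) mid′ + suc (countNode (i y) post₁)
        eq = trans (cong (countNode (i y)) post₂≡) (trans (countNode-++ (i y) mid′ (f₁ ∷ post₁))
          (cong (countNode (i y) mid′ +_) (countNode-hit (i y) f₁ post₁ f₁≡)))
      -- The hypothesis `x ⊑ y` says exactly that `j x` plus the length of the climb is at most
      -- `j y`.
      u-a : u a ≤ j y
      u-a = ≤-trans (walk-up a s 1≤a (subst (_< n)
              (trans (+-comm (level (i x)) (j x)) (cong₂ _+_ (sym u-x) level-x)) (bound x)))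
        (+-cancelʳ-≤ (level a) _ _ (≤-trans (≤-reflexive
          (trans (cong (λ z → z + length s + level a) u-x)
            (trans (lem (j x) (length s) (level a)) (cong (_+ j x) (sym level-x)))))
          (subst (λ z → level (i x) + j x ≤ j y + z) (sym level-a) x⊑y)))
        where
        lem : ∀ a b c → a + b + c ≡ c + b + a
        lem = solve-∀
      u-y : u (nodeFrom a t) ≤ j y
      u-y = walk-down a t (j y) 1≤a u-a
        (subst (_< n) (trans (+-comm (level (i y)) (j y)) (cong (j y +_) level-y)) (bound y))

  through : ∀ (h : ℕ → ℕ) K → (∀ v → 1 ≤ v → ShapeAt h v) → (∀ v → 1 ≤ v → h v < K) →
    (∀ v → 1 ≤ v → h v ≤ f∞ v) →
    ∃[ fs₁ ] ∃[ fs₂ ] Complete n (fs₁ ++ fs₂)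
      × (∀ v → 1 ≤ v → countNode v fs₁ + h v ≡ f∞ v) × (∀ v → 1 ≤ v → countNode v fs₂ ≡ h v)
  through h K shape h<K h≤f =
    let fs₁ , legal₁ , total₁ = reach h K shape h<K _ (λ v → f∞ v ∸ h v) start
          (λ v 1≤v → m+[n∸m]≡n (h≤f v 1≤v)) refl
        st₁ = run-state fs₁ start legal₁
        fs₂ , legal₂ , total₂ = reach (λ _ → 0) 1 flat-shape (λ _ _ → s≤s z≤n) _
          (λ v → f∞ v ∸ countNode v (fs₁ ʳ++ [])) st₁ (λ v 1≤v → m+[n∸m]≡n (bounded st₁ v 1≤v)) refl
        total₁₂ = λ v 1≤v → trans (sym (+-identityʳ _)) (total₂ v 1≤v)
        st₂ = run-state fs₂ st₁ legal₂
    in fs₁ , fs₂ ,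
       (Legal-++ fs₁ legal₁ legal₂ ,
        subst (Stable N) (sym (run-++ initial fs₁ fs₂)) (total-stable st₂
          (λ v 1≤v → trans (countNode-ʳ++ v fs₂ (fs₁ ʳ++ [])) (total₁₂ v 1≤v)))) ,
       total₁ ,
       (λ v 1≤v → +-cancelˡ-≡ (countNode v fs₁) _ _ (trans
          (cong (_+ countNode v fs₂) (sym (countNode-ʳ++ v fs₁ [])))
          (trans (total₁₂ v 1≤v) (sym (total₁ v 1≤v)))))

  -- If `x ⊑ y` fails, stop greedy play at the remainder `h`. Node `i y` then has `suc (j y)`
  -- firings left, so `y` is still to come, while `i x` has at most `j x` left, so `x` has been
  -- played: a complete sequence with `x` before `y`.
  ≤P⇒⊑ : ∀ {x y : Elem n} → x ≤P y → x ⊑ y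
  ≤P⇒⊑ {x} {y} x≤y = ≮⇒≥ absurd
    where
    e = path (i y)
    H = suc (j y)
    h : ℕ → ℕ
    h v = height H e (path v)
    H+common<n : ∀ v → H + common (path v) e < n
    H+common<n v = ≤-trans (≤-trans (≤-reflexive (sym (+-suc H (common (path v) e))))
        (+-monoʳ-≤ H (≤-trans (s≤s (≤-trans (≤-reflexive (common-sym (path v) e)) (common-≤ e (path v))))
          (≤-reflexive (sym (level-path (i y) (i-pos y)))))))
      (≤-trans (≤-reflexive (cong suc (+-comm (j y) (level (i y))))) (bound y))
    h<n : ∀ v → 1 ≤ v → h v < n
    h<n v _ = ≤-trans (s≤s (m∸n≤m _ (length (path v)))) (H+common<n v)
    h≤f : ∀ v → 1 ≤ v → h v ≤ f∞ v
    h≤f v 1≤v = ≤-trans (≤-trans (∸-monoˡ-≤ (suc (length (path v))) (H+common<n v))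
        (≤-reflexive (cong (n ∸_) (sym (level-path v 1≤v)))))
      (f∞-large v)
    absurd : ¬ j y + suc (common (path (i x)) e) < level (i x) + j x
    absurd lt =
      let fs₁ , fs₂ , complete , before , after = through h n (height-shape H e) h<n h≤f
          h-y≡ = height-on H e e (trans (cong (λ p → common p p) (sym (++-identityʳ e)))
                   (trans (common-prefix e [] []) (+-identityʳ _)))
          pre₂ , g₂ , post₂ , fs₂≡ , g₂≡ , cnt₂ = occurrence (i y) (j y) fs₂
            (≤-reflexive (sym (trans (after (i y) (i-pos y)) h-y≡)))
          -- The last `h (i x)` firings of `i x` belong to `fs₂`, so the index counted within `fs₁`
          -- alone is smaller by that amount.
          pre₁ , g₁ , post₁ , fs₁≡ , g₁≡ , cnt₁ = occurrence (i x) (j x ∸ h (i x)) fs₁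
            (+-cancelʳ-≤ (h (i x)) _ _ (≤-trans (s≤s (≤-reflexive (m∸n+n≡m h-x≤)))
              (≤-trans j<f (≤-reflexive (sym (before (i x) (i-pos x)))))))
          t₂≤t₁ = x≤y (fs₁ ++ fs₂) complete (length (fs₁ ++ pre₂)) (length pre₁)
            (fs₁ ++ pre₂ , g₂ , post₂ ,
              trans (cong (fs₁ ++_) fs₂≡) (sym (++-assoc fs₁ pre₂ (g₂ ∷ post₂))) ,
              refl , g₂≡ , cnt₂)
            (pre₁ , g₁ , post₁ ++ fs₂ ,
              trans (cong (_++ fs₂) fs₁≡) (++-assoc pre₁ (g₁ ∷ post₁) fs₂) ,
              refl , g₁≡ ,
              trans (countNode-++ (i x) post₁ fs₂)
                (trans (cong₂ _+_ cnt₁ (after (i x) (i-pos x))) (m∸n+n≡m h-x≤)))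
          t₁<t₂ = ≤-trans (≤-trans (s≤s (m≤m+n (length pre₁) (length post₁)))
              (≤-reflexive (trans (sym (+-suc (length pre₁) (length post₁)))
                (trans (sym (length-++ pre₁)) (cong length (sym fs₁≡))))))
            (≤-trans (m≤m+n (length fs₁) (length pre₂)) (≤-reflexive (sym (length-++ fs₁))))
      in <⇒≱ t₁<t₂ t₂≤t₁
      where
      h-x≤ : h (i x) ≤ j x
      h-x≤ = ≤-trans (∸-monoˡ-≤ (length (path (i x))) (s≤s⁻¹ (≤-trans
          (≤-reflexive (cong suc (sym (+-suc (j y) _))))
          (≤-trans lt (≤-reflexive (cong (_+ j x) (level-path (i x) (i-pos x))))))))
        (≤-reflexive (m+n∸m≡n (length (path (i x))) (j x)))
      j<f : j x < f∞ (i x)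
      j<f = ≤-trans (m+n≤o⇒m≤o∸n (suc (j x))
        (≤-trans (≤-reflexive (cong suc (+-comm (j x) (level (i x))))) (bound x))) (f∞-large (i x))

-- The lattice

-- p′ = m ∸ p and q′ = m ∸ q, stated without subtraction.
complement-⊔ : ∀ p p′ q q′ {m} → p + p′ ≡ m → q + q′ ≡ m → (p ⊔ q) + (p′ ⊓ q′) ≡ m
complement-⊔ p p′ q q′ eq eq′ with ≤-total p q
... | inj₁ p≤q rewrite m≤n⇒m⊔n≡n p≤q = trans (cong (q +_) (m≥n⇒m⊓n≡n
  (linear 0 (p≤q ⊞ ≤-reflexive (trans eq′ (sym eq))) (lem p p′ q q′)))) eq′
  where
  lem : ∀ p p′ q q′ → q′ + (q + (p + p′)) + 0 ≡ p′ + (p + (q + q′))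
  lem = solve-∀
... | inj₂ q≤p rewrite m≥n⇒m⊔n≡m q≤p = trans (cong (p +_) (m≤n⇒m⊓n≡m
  (linear 0 (q≤p ⊞ ≤-reflexive (trans eq (sym eq′))) (lem p p′ q q′)))) eq
  where
  lem : ∀ p p′ q q′ → p′ + (p + (q + q′)) + 0 ≡ q′ + (q + (p + p′))
  lem = solve-∀

⊔+⊓ : ∀ a b → (a ⊔ b) + (a ⊓ b) ≡ a + b
⊔+⊓ a b with ≤-total a b
... | inj₁ a≤b rewrite m≤n⇒m⊔n≡n a≤b | m≤n⇒m⊓n≡m a≤b = +-comm b a
... | inj₂ b≤a rewrite m≥n⇒m⊔n≡m b≤a | m≥n⇒m⊓n≡n b≤a = refl

module Valuation {A : Set} {_≈_ _⊴_ : A → A → Set} {_∨_ _∧_ : A → A → A}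
    (isLattice : IsLattice _≈_ _⊴_ _∨_ _∧_) (rank : A → ℕ)
    (rank-cong : ∀ {x y} → x ≈ y → rank x ≡ rank y)
    (rigid : ∀ {x y} → x ⊴ y → rank y ≤ rank x → x ≈ y)
    (valuation : ∀ x y → rank x + rank y ≡ rank (x ∨ y) + rank (x ∧ y)) where

  open IsLattice isLattice using (antisym; x≤x∨y; y≤x∨y; ∨-least; x∧y≤x; x∧y≤y; ∧-greatest)
    renaming (trans to ⊴-trans)

  -- The left side lies below the right in any lattice, so equal ranks suffice. Since x ∧ (y ∧ z) =
  -- x ∧ y and (x ∨ y) ∨ z = y ∨ z, the valuation reduces both ranks to r(x) + r(y) + r(z) - r(x ∧
  -- y) - r(y ∨ z).
  modular : ∀ x y z → x ⊴ z → (x ∨ (y ∧ z)) ≈ ((x ∨ y) ∧ z)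
  modular x y z x≤z = rigid
    (∧-greatest (∨-least (x≤x∨y x y) (⊴-trans (x∧y≤x y z) (y≤x∨y x y))) (∨-least x≤z (x∧y≤y y z)))
    (≤-reflexive (lem (rank x) (rank y) (rank z) (rank (x ∧ y)) (rank (y ∧ z))
      (rank (x ∨ y)) (rank (y ∨ z)) (rank (x ∨ (y ∧ z))) (rank ((x ∨ y) ∧ z))
      (trans (valuation x (y ∧ z)) (cong (rank (x ∨ (y ∧ z)) +_) (rank-cong meet≈)))
      (trans (valuation (x ∨ y) z) (cong (_+ rank ((x ∨ y) ∧ z)) (rank-cong join≈)))
      (valuation x y) (valuation y z)))
    where
    meet≈ : (x ∧ (y ∧ z)) ≈ (x ∧ y)
    meet≈ = antisym (∧-greatest (x∧y≤x _ _) (⊴-trans (x∧y≤y _ _) (x∧y≤x _ _)))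
      (∧-greatest (x∧y≤x _ _) (∧-greatest (x∧y≤y _ _) (⊴-trans (x∧y≤x _ _) x≤z)))
    join≈ : ((x ∨ y) ∨ z) ≈ (y ∨ z)
    join≈ = antisym (∨-least (∨-least (⊴-trans x≤z (y≤x∨y _ _)) (x≤x∨y _ _)) (y≤x∨y _ _))
      (∨-least (⊴-trans (y≤x∨y _ _) (x≤x∨y _ _)) (y≤x∨y _ _))
    lem : ∀ x y z mxy myz jxy jyz A B → x + myz ≡ A + mxy → jxy + z ≡ jyz + B →
      x + y ≡ jxy + mxy → y + z ≡ jyz + myz → B ≡ A
    lem x y z mxy myz jxy jyz A B e₁ e₂ e₃ e₄ = +-cancelʳ-≡ (mxy + jyz + (x + myz) + (jxy + z)) _ _ (begin
      B + (mxy + jyz + (x + myz) + (jxy + z))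
        ≡⟨ s₁ B mxy jyz x myz jxy z ⟩
      (jyz + B) + (jxy + mxy) + (x + (myz + z))
        ≡⟨ cong₂ (λ p q → p + q + (x + (myz + z))) (sym e₂) (sym e₃) ⟩
      (jxy + z) + (x + y) + (x + (myz + z))
        ≡⟨ s₂ jxy z x y myz ⟩
      (x + myz) + (y + z) + (x + (jxy + z))
        ≡⟨ cong₂ (λ p q → p + q + (x + (jxy + z))) e₁ e₄ ⟩
      (A + mxy) + (jyz + myz) + (x + (jxy + z))
        ≡⟨ s₃ A mxy jyz myz x jxy z ⟩
      A + (mxy + jyz + (x + myz) + (jxy + z)) ∎)
      where
      open ≡-Reasoning
      s₁ : ∀ B mxy jyz x myz jxy z → B + (mxy + jyz + (x + myz) + (jxy + z))
        ≡ (jyz + B) + (jxy + mxy) + (x + (myz + z))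
      s₁ = solve-∀
      s₂ : ∀ jxy z x y myz → (jxy + z) + (x + y) + (x + (myz + z))
        ≡ (x + myz) + (y + z) + (x + (jxy + z))
      s₂ = solve-∀
      s₃ : ∀ A mxy jyz myz x jxy z → (A + mxy) + (jyz + myz) + (x + (jxy + z))
        ≡ A + (mxy + jyz + (x + myz) + (jxy + z))
      s₃ = solve-∀

-- Joins, duality and rank for the explicit order.

module Lattice-of-moves (n : ℕ) where

  P : Elem n → List Bool
  P x = path (i x)

  len : Elem n → ℕ
  len x = length (P x)

  cp : Elem n → Elem n → ℕ
  cp x y = common (P x) (P y)

  -- len x + 1 is the level of x, so that W x + 1 = level + j.
  W : Elem n → ℕ
  W x = len x + j x

  infix 4 _≼_
  -- `⊑` with the offset between level and depth cancelled. As a record it lets `x` and `y` be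
  -- inferred from a proof.
  record _≼_ (x y : Elem n) : Set where
    constructor below
    field W≤j+cp : W x ≤ j y + cp x y
  open _≼_

  cp-sym : ∀ x y → cp x y ≡ cp y x
  cp-sym x y = common-sym (P x) (P y)

  cp≤ˡ : ∀ x y → cp x y ≤ len x
  cp≤ˡ x y = common-≤ (P x) (P y)

  cp≤ʳ : ∀ x y → cp x y ≤ len y
  cp≤ʳ x y = subst (_≤ len y) (cp-sym y x) (cp≤ˡ y x)

  level-len : ∀ x → level (i x) ≡ suc (len x)
  level-len x = level-path (i x) (i-pos x)

  W<n : ∀ x → suc (suc (W x)) ≤ n
  W<n x = subst (λ ℓ → ℓ + j x < n) (level-len x) (bound x)

  ρ-W : ∀ x → ρ x ≡ suc (W x + j x)
  ρ-W x = trans (cong (_+ 2 * j x) (level-len x)) (lem (len x) (j x))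
    where
    lem : ∀ l j → suc l + 2 * j ≡ suc (l + j + j)
    lem = solve-∀

  ≈-sym : ∀ {x y : Elem n} → x ≈P y → y ≈P x
  ≈-sym (a , b) = sym a , sym b

  ρ-cong : ∀ {x y : Elem n} → x ≈P y → ρ x ≡ ρ y
  ρ-cong (a , b) = cong₂ (λ v m → level v + 2 * m) a b

  ≼-reflexive : ∀ {x y} → x ≈P y → x ≼ y
  ≼-reflexive {x} (a , b) = below (≤-reflexive (trans (+-comm (len x) (j x))
    (cong₂ _+_ b (trans (sym (common-self (P x))) (cong (λ v → common (P x) (path v)) a)))))

  ≼⇒W≤ : ∀ {x y} → x ≼ y → W x ≤ W y
  ≼⇒W≤ {x} {y} (below le) =
    ≤-trans le (≤-trans (+-monoʳ-≤ (j y) (cp≤ʳ x y)) (≤-reflexive (+-comm (j y) (len y))))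

  ≼⇒j≤ : ∀ {x y} → x ≼ y → j x ≤ j y
  ≼⇒j≤ {x} {y} (below le) = +-cancelˡ-≤ (len x) _ _ (≤-trans le
    (≤-trans (+-monoʳ-≤ (j y) (cp≤ˡ x y)) (≤-reflexive (+-comm (j y) (len x)))))

  -- One of the overlaps `cp x y` and `cp y z` is at most `cp x z`. In the first case monotonicity
  -- of `j` finishes, in the second that of `W`.
  ≼-trans : ∀ {x y z} → x ≼ y → y ≼ z → x ≼ z
  ≼-trans {x} {y} {z} x≼y y≼z = below ([
    (λ le → ≤-trans (W≤j+cp x≼y) (≼⇒j≤ y≼z ⊞ le)) ,
    (λ le → ≤-trans (≼⇒W≤ x≼y) (≤-trans (W≤j+cp y≼z) (+-monoʳ-≤ (j z) le)))
    ]′ (common-ultrametric (P x) (P y) (P z)))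

  -- Equality of ranks forces equality of both W and j, which do not decrease along ≼.
  ≼-rank : ∀ {x y} → x ≼ y → ρ y ≤ ρ x → x ≈P y
  ≼-rank {x} {y} x≼y ρ≤ =
    trans (sym (node-path (i x) (i-pos x))) (trans (cong (nodeFrom 1) P≡) (node-path (i y) (i-pos y))) ,
    j≡
    where
    ρ≤′ : W y + j y ≤ W x + j x
    ρ≤′ = s≤s⁻¹ (subst₂ _≤_ (ρ-W y) (ρ-W x) ρ≤)
    j≡ : j x ≡ j y
    j≡ = ≤-antisym (≼⇒j≤ x≼y) (linear 0 (ρ≤′ ⊞ ≼⇒W≤ x≼y) (lem (j x) (j y) (W x) (W y)))
      where
      lem : ∀ a b c d → b + (c + a + d) + 0 ≡ a + (d + b + c)
      lem = solve-∀
    W≥ : W y ≤ W x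
    W≥ = linear 0 (ρ≤′ ⊞ ≼⇒j≤ x≼y) (lem (j x) (j y) (W x) (W y))
      where
      lem : ∀ a b c d → d + (c + a + b) + 0 ≡ c + (d + b + a)
      lem = solve-∀
    P≡ : P x ≡ P y
    P≡ = common-equal (P x) (P y)
      (+-cancelˡ-≤ (j y) _ _
        (≤-trans (≤-reflexive (+-comm (j y) (len y))) (≤-trans W≥ (W≤j+cp x≼y))))
      (+-cancelʳ-≤ (j x) _ _ (≤-trans (≼⇒W≤ x≼y) (≤-reflexive (cong (len y +_) (sym j≡)))))

  ≼-antisym : ∀ {x y} → x ≼ y → y ≼ x → x ≈P y
  ≼-antisym {x} {y} x≼y y≼x = ≼-rank x≼y (subst₂ _≤_ (sym (ρ-W y)) (sym (ρ-W x))
    (s≤s (≼⇒W≤ y≼x ⊞ ≼⇒j≤ y≼x)))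

  mk : (p : List Bool) (m : ℕ) → suc (suc (length p + m)) ≤ n → Elem n
  mk p m le = elem (nodeFrom 1 p) m (nodeFrom-pos 1 p ≤-refl)
    (subst (λ ℓ → ℓ + m < n) (sym (level-nodeFrom 1 p ≤-refl)) le)

  -- Climbs to the ancestor of depth `k` with `W` unchanged, so `j` gains one per level.
  raise : (x : Elem n) (k : ℕ) → k ≤ len x → Elem n
  raise x k k≤ = mk (take k (P x)) (W x ∸ k)
    (subst (λ m → suc (suc m) ≤ n) (sym eq) (W<n x))
    where
    eq : length (take k (P x)) + (W x ∸ k) ≡ W x
    eq = trans (cong (_+ (W x ∸ k)) (trans (length-take k (P x)) (m≤n⇒m⊓n≡m k≤)))
      (m+[n∸m]≡n (≤-trans k≤ (m≤m+n (len x) (j x))))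

  module Raise x k (k≤ : k ≤ len x) where
    r = raise x k k≤

    len-raise : len r ≡ k
    len-raise = trans (cong length (path-node (take k (P x))))
      (trans (length-take k (P x)) (m≤n⇒m⊓n≡m k≤))

    j-raise : j r + k ≡ W x
    j-raise = m∸n+n≡m (≤-trans k≤ (m≤m+n (len x) (j x)))

    W-raise : W r ≡ W x
    W-raise = trans (cong (_+ j r) len-raise) (trans (+-comm k (j r)) j-raise)

    cp-raise : ∀ z → cp r z ≡ k ⊓ cp x z
    cp-raise z = trans (cong (λ p → common p (P z)) (path-node (take k (P x))))
      (common-take k (P x) (P z) k≤)

    ≼-raise : x ≼ r
    ≼-raise = below (≤-reflexive (trans (sym j-raise) (cong (j r +_) (sym (trans (cp-sym x r)
      (trans (cp-raise x) (trans (cong (k ⊓_) (common-self (P x))) (m≤n⇒m⊓n≡m k≤))))))))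

  -- The greatest depth at which an ancestor of x, taken with the same W, dominates y (if W y ≤ W x).
  meeting : Elem n → Elem n → ℕ
  meeting x y = len x ⊓ (cp x y + (W x ∸ W y))

  module Join-ordered x y (W≤ : W y ≤ W x) where
    k = meeting x y
    k≤ : k ≤ len x
    k≤ = m⊓n≤m (len x) _
    open Raise x k k≤ public

    cp≤k : cp x y ≤ k
    cp≤k = ⊓-glb (cp≤ˡ x y) (m≤m+n _ _)

    cp-r : cp r y ≡ cp x y
    cp-r = trans (cp-raise y) (m≥n⇒m⊓n≡n cp≤k)

    k≤′ : W y + k ≤ W x + cp x y
    k≤′ = ≤-trans (+-monoʳ-≤ (W y) (m⊓n≤n (len x) _))
      (≤-reflexive (trans (lem (W y) (cp x y) (W x ∸ W y)) (cong (_+ cp x y) (m+[n∸m]≡n W≤))))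
      where
      lem : ∀ a b c → a + (b + c) ≡ a + c + b
      lem = solve-∀

    y≼r : y ≼ r
    y≼r = below (subst (λ z → W y ≤ j r + z) (sym (trans (cp-sym y r) cp-r))
      (linear 0 (k≤′ ⊞ ≤-reflexive (sym j-raise)) (lem (W y) (j r) (cp x y) k (W x))))
      where
      lem : ∀ a r c k w → a + (w + c + (r + k)) + 0 ≡ r + c + (a + k + w)
      lem = solve-∀

    least : ∀ z → x ≼ z → y ≼ z → r ≼ z
    least z (below x≼z) (below y≼z) =
      below (subst₂ (λ a b → a ≤ j z + b) (sym W-raise) (sym (cp-raise z)) main)
      where
      -- By the ultrametric inequality one of the overlaps of `z` with `x` and with `y` is at most
      -- `cp x y`; the corresponding bound on `W x` or `W y` is used.
      W-y : W y ≤ j z + cp x y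
      W-y = [ (λ le → ≤-trans W≤ (≤-trans x≼z (+-monoʳ-≤ (j z) le)))
            , (λ le → ≤-trans y≼z (+-monoʳ-≤ (j z)
                 (≤-trans (≤-reflexive (cp-sym y z)) le))) ]′ (common-ultrametric (P x) (P z) (P y))
      W-x : W x ≤ j z + k
      W-x with ⊓-sel (len x) (cp x y + (W x ∸ W y))
      ... | inj₁ eq = ≤-trans x≼z (+-monoʳ-≤ (j z) (≤-trans (cp≤ˡ x z) (≤-reflexive (sym eq))))
      ... | inj₂ eq = ≤-trans (≤-reflexive (sym (m+[n∸m]≡n W≤)))
        (≤-trans (+-monoˡ-≤ (W x ∸ W y) W-y)
          (≤-reflexive (trans (+-assoc (j z) _ _) (cong (j z +_) (sym eq)))))
      main : W x ≤ j z + (k ⊓ cp x z)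
      main with ⊓-sel k (cp x z)
      ... | inj₁ eq = ≤-trans W-x (≤-reflexive (cong (j z +_) (sym eq)))
      ... | inj₂ eq = ≤-trans x≼z (≤-reflexive (cong (j z +_) (sym eq)))

    -- In integers, `j r` is the maximum of `j x`, `j y` and (W x ⊓ W y) - cp x y, the least value
    -- allowed by dominating both elements. Adding `cp x y` avoids the subtraction.
    j-join : j r + cp x y ≡ ((j x ⊔ j y) + cp x y) ⊔ (W x ⊓ W y)
    j-join = ≤-antisym upper
      (⊔-lub (+-monoˡ-≤ (cp x y) (⊔-lub (≼⇒j≤ ≼-raise) (≼⇒j≤ y≼r)))
        (≤-trans (m⊓n≤n (W x) (W y))
          (≤-trans (W≤j+cp y≼r) (≤-reflexive (cong (j r +_) (trans (cp-sym y r) cp-r))))))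
      where
      upper : j r + cp x y ≤ ((j x ⊔ j y) + cp x y) ⊔ (W x ⊓ W y)
      upper with ⊓-sel (len x) (cp x y + (W x ∸ W y))
      ... | inj₁ eq = ≤-trans (+-monoˡ-≤ (cp x y) (≤-trans (≤-reflexive (+-cancelʳ-≡ (len x) _ _
              (trans (cong (j r +_) (sym eq)) (trans j-raise (+-comm (len x) (j x))))))
              (m≤m⊔n (j x) (j y))))
          (m≤m⊔n _ _)
      ... | inj₂ eq = ≤-trans (≤-reflexive (trans (+-cancelʳ-≡ (W x ∸ W y) _ _
              (trans (+-assoc (j r) _ _) (trans (cong (j r +_) (sym eq))
                (trans j-raise (sym (m+[n∸m]≡n W≤)))))) (sym (m≥n⇒m⊓n≡n W≤))))
          (m≤n⊔m _ (W x ⊓ W y))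

    W-join : W r ≡ W x ⊔ W y
    W-join = trans W-raise (sym (m≥n⇒m⊔n≡m W≤))

  -- All that later arguments see of the join. It is symmetric in `x` and `y`, unlike the
  -- construction, which climbs from the element with the larger `W`.
  record IsJoin (x y z : Elem n) : Set where
    field
      upperˡ : x ≼ z
      upperʳ : y ≼ z
      least  : ∀ t → x ≼ t → y ≼ t → z ≼ t
      W-join : W z ≡ W x ⊔ W y
      j-join : j z + cp x y ≡ ((j x ⊔ j y) + cp x y) ⊔ (W x ⊓ W y)

  abstract
    join′ : ∀ x y → ∃[ z ] IsJoin x y z
    join′ x y with ≤-total (W y) (W x)
    ... | inj₁ W≤ = r , record
      { upperˡ = ≼-raise ; upperʳ = y≼r ; least = least ; W-join = W-join ; j-join = j-join }
      where open Join-ordered x y W≤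
    ... | inj₂ W≤ = r , record
      { upperˡ = y≼r ; upperʳ = ≼-raise ; least = λ t x≼t y≼t → least t y≼t x≼t
      ; W-join = trans W-join (⊔-comm (W y) (W x))
      ; j-join = subst (λ c → j r + c ≡ ((j x ⊔ j y) + c) ⊔ (W x ⊓ W y)) (cp-sym y x)
          (trans j-join (cong₂ _⊔_ (cong (_+ cp y x) (⊔-comm (j y) (j x))) (⊓-comm (W y) (W x)))) }
      where open Join-ordered y x W≤

  join : Elem n → Elem n → Elem n
  join x y = proj₁ (join′ x y)

  module Join x y = IsJoin (proj₂ (join′ x y))

  dual : Elem n → Elem n
  dual x = elem (i x) (n ∸ 1 ∸ level (i x) ∸ j x) (i-pos x) (begin-strict
    level (i x) + (n ∸ 1 ∸ level (i x) ∸ j x)   ≤⟨ +-monoʳ-≤ (level (i x)) (m∸n≤m _ (j x)) ⟩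
    level (i x) + (n ∸ 1 ∸ level (i x))         ≡⟨ m+[n∸m]≡n ℓ≤ ⟩
    n ∸ 1                                       <⟨ ∸-monoʳ-< {n} {1} {0} (s≤s z≤n) (≤-trans (s≤s z≤n) (W<n x)) ⟩
    n                                           ∎)
    where
    open ≤-Reasoning
    ℓ≤ : level (i x) ≤ n ∸ 1
    ℓ≤ = ≤-trans (m≤m+n _ (j x)) (∸-monoˡ-≤ 1 (bound x))

  -- `W x` is one less than level + j, hence at most n - 2, so complementing in `n ∸ 2` loses
  -- nothing to truncation.
  dual-j : ∀ x → j (dual x) + W x ≡ n ∸ 2
  dual-j x = trans (cong (_+ W x) eq) (m∸n+n≡m (∸-monoˡ-≤ 2 (W<n x)))
    where
    eq : n ∸ 1 ∸ level (i x) ∸ j x ≡ n ∸ 2 ∸ W x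
    eq = trans (cong (λ ℓ → n ∸ 1 ∸ ℓ ∸ j x) (level-len x))
      (trans (cong (_∸ j x) (trans (∸-+-assoc n 1 (suc (len x))) (sym (∸-+-assoc n 2 (len x)))))
        (∸-+-assoc (n ∸ 2) (len x) (j x)))

  dual-W : ∀ x → W (dual x) + j x ≡ n ∸ 2
  dual-W x = trans (lem (len x) (j (dual x)) (j x)) (dual-j x)
    where
    lem : ∀ l d j → l + d + j ≡ d + (l + j)
    lem = solve-∀

  dual-involutive : ∀ x → dual (dual x) ≈P x
  dual-involutive x = refl , +-cancelʳ-≡ (W (dual x)) _ _
    (trans (dual-j (dual x)) (trans (sym (dual-W x)) (+-comm (W (dual x)) (j x))))

  -- The nodes and hence `cp` stay put, while W(x) and j(y) become (n - 2) - j(dual x) and (n - 2) -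
  -- W(dual y): the inequality is the same one read backwards.
  dual-anti : ∀ {x y} → x ≼ y → dual y ≼ dual x
  dual-anti {x} {y} (below x≼y) = below (linear 0
    (x≼y ⊞ ≤-reflexive (trans (dual-W y) (sym (dual-j x))) ⊞ ≤-reflexive (cp-sym x y))
    (lem (W (dual y)) (j (dual x)) (W x) (j y) (cp x y) (cp y x)))
    where
    lem : ∀ a b w j c c′ → a + (j + c + (b + w) + c′) + 0 ≡ b + c′ + (w + (a + j) + c)
    lem = solve-∀

  dual-swapˡ : ∀ {x y} → dual x ≼ y → dual y ≼ x
  dual-swapˡ {x} le = ≼-trans (dual-anti le) (≼-reflexive (dual-involutive x))

  dual-swapʳ : ∀ {x y} → x ≼ dual y → y ≼ dual x
  dual-swapʳ {y = y} le =
    ≼-trans (≼-reflexive (≈-sym {dual (dual y)} {y} (dual-involutive y))) (dual-anti le)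

  dual-anti⁻¹ : ∀ {x y} → dual y ≼ dual x → x ≼ y
  dual-anti⁻¹ {y = y} le = ≼-trans (dual-swapʳ le) (≼-reflexive (dual-involutive y))

  meet : Elem n → Elem n → Elem n
  meet x y = dual (join (dual x) (dual y))

  meet-lowerˡ : ∀ x y → meet x y ≼ x
  meet-lowerˡ x y = dual-swapˡ (Join.upperˡ (dual x) (dual y))

  meet-lowerʳ : ∀ x y → meet x y ≼ y
  meet-lowerʳ x y = dual-swapˡ (Join.upperʳ (dual x) (dual y))

  meet-greatest : ∀ x y z → z ≼ x → z ≼ y → z ≼ meet x y
  meet-greatest x y z z≼x z≼y =
    dual-swapʳ (Join.least (dual x) (dual y) (dual z) (dual-anti z≼x) (dual-anti z≼y))

  j-meet : ∀ x y → j (meet x y) ≡ j x ⊓ j y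
  j-meet x y = +-cancelˡ-≡ (W (dual x) ⊔ W (dual y)) _ _ (trans (+-comm _ (j (meet x y)))
    (trans (cong (j (meet x y) +_) (sym (Join.W-join (dual x) (dual y))))
      (trans (dual-j (join (dual x) (dual y))) (sym (complement-⊔ (W (dual x)) (j x) (W (dual y)) (j y) (dual-W x) (dual-W y))))))

  -- `j-join` for the duals, complemented in `n ∸ 2 + c`; the maximum becomes a minimum.
  W-meet : ∀ x y → W (meet x y) ≡ (W x ⊓ W y) ⊓ ((j x ⊔ j y) + cp x y)
  W-meet x y = +-cancelˡ-≡ (j J + c) _ _ (trans (lem (j J) c (W (meet x y)))
      (trans (cong (_+ c) (dual-W J))
        (sym (trans (cong (_+ ((W x ⊓ W y) ⊓ ((j x ⊔ j y) + c))) (Join.j-join (dual x) (dual y)))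
          (complement-⊔ ((j (dual x) ⊔ j (dual y)) + c) (W x ⊓ W y)
            (W (dual x) ⊓ W (dual y)) ((j x ⊔ j y) + c) eq₁ eq₂)))))
    where
    J = join (dual x) (dual y)
    c = cp x y
    lem : ∀ a b c → a + b + c ≡ c + a + b
    lem = solve-∀
    lem₁ : ∀ a b c → a + b + c ≡ a + c + b
    lem₁ = solve-∀
    eq₁ : (j (dual x) ⊔ j (dual y)) + c + (W x ⊓ W y) ≡ n ∸ 2 + c
    eq₁ = trans (lem₁ _ c (W x ⊓ W y)) (cong (_+ c) (complement-⊔ (j (dual x)) (W x) (j (dual y)) (W y) (dual-j x) (dual-j y)))
    eq₂ : (W (dual x) ⊓ W (dual y)) + ((j x ⊔ j y) + c) ≡ n ∸ 2 + c
    eq₂ = trans (sym (+-assoc (W (dual x) ⊓ W (dual y)) _ c)) (cong (_+ c)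
      (trans (+-comm _ (j x ⊔ j y)) (complement-⊔ (j x) (W (dual x)) (j y) (W (dual y))
        (trans (+-comm (j x) _) (dual-W x)) (trans (+-comm (j y) _) (dual-W y)))))

  -- `W` of the join and `j` of the meet are the maximum of the `W` and the minimum of the `j`. The
  -- other two quantities, `j J + c` and `W M`, are the maximum and minimum of one pair, `a + c` and
  -- `b`. Maximum plus minimum is the sum, and `c` cancels.
  rank-valuation : ∀ x y → ρ x + ρ y ≡ ρ (join x y) + ρ (meet x y)
  rank-valuation x y = begin
    ρ x + ρ y
      ≡⟨ cong₂ _+_ (ρ-W x) (ρ-W y) ⟩
    suc (W x + j x) + suc (W y + j y)
      ≡⟨ s₁ (W x) (j x) (W y) (j y) ⟩
    2 + ((W x + W y) + (j x + j y))
      ≡⟨ cong (2 +_) (cong₂ _+_ (sym (⊔+⊓ (W x) (W y))) (sym (⊔+⊓ (j x) (j y)))) ⟩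
    2 + (((W x ⊔ W y) + b) + (a + (j x ⊓ j y)))
      ≡⟨ cong (λ z → 2 + z) (+-cancelʳ-≡ c _ _ (begin
          (W x ⊔ W y) + b + (a + (j x ⊓ j y)) + c
            ≡⟨ s₂ (W x ⊔ W y) b a (j x ⊓ j y) c ⟩
          (W x ⊔ W y) + ((a + c) + b) + (j x ⊓ j y)
            ≡⟨ cong (λ z → (W x ⊔ W y) + z + (j x ⊓ j y)) (sym (⊔+⊓ (a + c) b)) ⟩
          (W x ⊔ W y) + (((a + c) ⊔ b) + ((a + c) ⊓ b)) + (j x ⊓ j y)
            ≡⟨ cong₂ (λ s t → (W x ⊔ W y) + (s + t) + (j x ⊓ j y)) (sym (Join.j-join x y))
                 (trans (⊓-comm (a + c) b) (sym (W-meet x y))) ⟩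
          (W x ⊔ W y) + ((j J + c) + W M) + (j x ⊓ j y)
            ≡⟨ cong₂ (λ s t → s + ((j J + c) + W M) + t) (sym (Join.W-join x y)) (sym (j-meet x y)) ⟩
          W J + ((j J + c) + W M) + j M
            ≡⟨ s₃ (W J) (j J) c (W M) (j M) ⟩
          (W J + j J) + (W M + j M) + c ∎)) ⟩
    2 + ((W J + j J) + (W M + j M))
      ≡⟨ s₄ (W J + j J) (W M + j M) ⟩
    suc (W J + j J) + suc (W M + j M)
      ≡⟨ sym (cong₂ _+_ (ρ-W J) (ρ-W M)) ⟩
    ρ J + ρ M ∎
    where
    open ≡-Reasoning
    J = join x y
    M = meet x y
    a = j x ⊔ j y
    b = W x ⊓ W y
    c = cp x y
    s₁ : ∀ p q r s → suc (p + q) + suc (r + s) ≡ 2 + ((p + r) + (q + s))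
    s₁ = solve-∀
    s₂ : ∀ w b a m c → w + b + (a + m) + c ≡ w + ((a + c) + b) + m
    s₂ = solve-∀
    s₃ : ∀ w p c v q → w + ((p + c) + v) + q ≡ (w + p) + (v + q) + c
    s₃ = solve-∀
    s₄ : ∀ p q → 2 + (p + q) ≡ suc p + suc q
    s₄ = solve-∀

  -- If the node of `x` is no ancestor of that of `y`, one step up with `W` fixed stays below `y`.
  -- If it is an ancestor or the same node, one step down towards `y` with `j` fixed does. Either
  -- way just one of `W` and `j` grows by one.
  between : ∀ x y → x ≼ y → ¬ x ≈P y → ∃[ z ] x ≼ z × z ≼ y × ρ z ≡ suc (ρ x)
  between x y x≼y x≉y with m≤n⇒m<n∨m≡n (cp≤ˡ x y)
  ... | inj₁ cp<len = r , ≼-raise , r≼y , rank-r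
    where
    k≤ : pred (len x) ≤ len x
    k≤ = pred[n]≤n
    open Raise x (pred (len x)) k≤
    r≼y : r ≼ y
    r≼y = below (subst₂ (λ a b → a ≤ j y + b) (sym W-raise)
      (sym (trans (cp-raise y) (m≥n⇒m⊓n≡n (pred-mono-≤ cp<len)))) (W≤j+cp x≼y))
    j-r : j r ≡ suc (j x)
    j-r = +-cancelʳ-≡ (pred (len x)) _ _ (trans j-raise
      (trans (cong (_+ j x) (sym (suc-pred (len x) {{>-nonZero (≤-trans (s≤s z≤n) cp<len)}})))
        (cong suc (+-comm (pred (len x)) (j x)))))
    rank-r : ρ r ≡ suc (ρ x)
    rank-r = trans (ρ-W r) (cong suc (trans (cong₂ _+_ W-raise j-r)
      (trans (+-suc (W x) (j x)) (sym (ρ-W x)))))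
  ... | inj₂ cp≡len with common-full (P x) (P y) cp≡len
  ...   | r , Py≡ = z , x≼z , z≼y , rank-z
    where
    towards : List Bool → Bool
    -- For equal nodes either child will do: there `j x` is strictly smaller than `j y`.
    towards []      = false
    towards (b ∷ _) = b
    b = towards r
    p′ = P x ∷ʳ b
    cp-z : common p′ (P y) ≡ len x + common (b ∷ []) r
    cp-z = trans (cong (common p′) Py≡) (common-prefix (P x) (b ∷ []) r)
    j-step : ∀ r → P y ≡ P x ++ r → suc (j x) ≤ j y + common (towards r ∷ []) r
    j-step [] eq = ≤-trans (≤∧≢⇒< (≼⇒j≤ x≼y) (λ j≡ → x≉y (same , j≡))) (m≤m+n _ 0)
      where
      same : i x ≡ i y
      same = trans (sym (node-path (i x) (i-pos x))) (trans (cong (nodeFrom 1)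
        (trans (sym (++-identityʳ (P x))) (sym eq))) (node-path (i y) (i-pos y)))
    j-step (true ∷ _)  _ = subst (suc (j x) ≤_) (+-comm 1 (j y)) (s≤s (≼⇒j≤ x≼y))
    j-step (false ∷ _) _ = subst (suc (j x) ≤_) (+-comm 1 (j y)) (s≤s (≼⇒j≤ x≼y))
    W-z : length p′ + j x ≡ suc (W x)
    W-z = cong (_+ j x) (length-snoc (P x) b)
    p′≼ : length p′ + j x ≤ j y + common p′ (P y)
    p′≼ = subst₂ (λ s t → s ≤ j y + t) (sym W-z) (sym cp-z)
      (≤-trans (≤-reflexive (sym (+-suc (len x) (j x))))
        (≤-trans (+-monoʳ-≤ (len x) (j-step r Py≡))
          (≤-reflexive (lem (len x) (j y) (common (b ∷ []) r)))))
      where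
      lem : ∀ a b c → a + (b + c) ≡ b + (a + c)
      lem = solve-∀
    -- Descending raises `W`, but being below `y` keeps it within `W y`, so the move stays in the
    -- endgame.
    z = mk p′ (j x) (≤-trans (s≤s (s≤s (≤-trans p′≼ (≤-trans (+-monoʳ-≤ (j y)
      (≤-trans (≤-reflexive (common-sym p′ (P y))) (common-≤ (P y) p′)))
      (≤-reflexive (+-comm (j y) (len y))))))) (W<n y))
    Pz : P z ≡ p′
    Pz = path-node p′
    z≼y : z ≼ y
    z≼y = below (subst (λ p → length p + j x ≤ j y + common p (P y)) (sym Pz) p′≼)
    x≼z : x ≼ z
    x≼z = below (≤-reflexive (trans (+-comm (len x) (j x)) (cong (j x +_) (sym (trans
      (cong₂ common (sym (++-identityʳ (P x))) Pz)
      (trans (common-prefix (P x) [] (b ∷ [])) (+-identityʳ _)))))))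
    rank-z : ρ z ≡ suc (ρ x)
    rank-z = trans (ρ-W z) (cong suc (trans (cong (_+ j x) (trans (cong (λ p → length p + j x) Pz) W-z))
      (sym (ρ-W x))))

-- Transfer of the lattice and its symmetries to the firing order.

module Conclusion (n : ℕ) (2≤n : 2 ≤ n) where
  open Lattice-of-moves n
  open _≼_
  open Firing-dynamics n 2≤n using (⊑⇒≤P; ≤P⇒⊑)

  ≤P⇒≼ : ∀ {x y} → x ≤P y → x ≼ y
  ≤P⇒≼ {x} {y} x≤y = below (s≤s⁻¹ (subst₂ _≤_ (cong (_+ j x) (level-len x)) (+-suc (j y) (cp x y))
    (≤P⇒⊑ {x} {y} x≤y)))

  ≼⇒≤P : ∀ {x y} → x ≼ y → x ≤P y
  ≼⇒≤P {x} {y} (below x≼y) = ⊑⇒≤P {x} {y} (subst₂ _≤_ (cong (_+ j x) (sym (level-len x)))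
    (sym (+-suc (j y) (cp x y))) (s≤s x≼y))

  isLattice : IsLattice _≈P_ _≤P_ join meet
  isLattice = record
    { isPartialOrder = record
      { isPreorder = record
        { isEquivalence = record
          { refl  = refl , refl
          ; sym   = λ {x} {y} → ≈-sym {x} {y}
          ; trans = λ (a , b) (c , d) → trans a c , trans b d
          }
        ; reflexive = λ {x} {y} x≈y → ≼⇒≤P {x} {y} (≼-reflexive x≈y)
        ; trans = λ {x} {y} {z} x≤y y≤z →
            ≼⇒≤P {x} {z} (≼-trans (≤P⇒≼ {x} {y} x≤y) (≤P⇒≼ {y} {z} y≤z))
        }
      ; antisym = λ {x} {y} x≤y y≤x → ≼-antisym (≤P⇒≼ {x} {y} x≤y) (≤P⇒≼ {y} {x} y≤x)
      }
    ; supremum = λ x y → ≼⇒≤P (Join.upperˡ x y) , ≼⇒≤P (Join.upperʳ x y) ,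
        λ z x≤z y≤z → ≼⇒≤P (Join.least x y z (≤P⇒≼ {x} {z} x≤z) (≤P⇒≼ {y} {z} y≤z))
    ; infimum = λ x y → ≼⇒≤P (meet-lowerˡ x y) , ≼⇒≤P (meet-lowerʳ x y) ,
        λ z z≤x z≤y → ≼⇒≤P (meet-greatest x y z (≤P⇒≼ {z} {x} z≤x) (≤P⇒≼ {z} {y} z≤y))
    }

  modular : ∀ x y z → x ≤P z → join x (meet y z) ≈P meet (join x y) z
  modular = Valuation.modular isLattice ρ (λ {x} {y} → ρ-cong {x} {y})
    (λ {x} {y} x≤y → ≼-rank (≤P⇒≼ {x} {y} x≤y)) rank-valuation

  covers : ∀ (x y : Elem n) → x <P y → (∀ z → x <P z → z <P y → ⊥) → ρ y ≡ suc (ρ x)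
  covers x y (x≤y , x≉y) none =
    let z , x≼z , z≼y , ρz≡ = between x y (≤P⇒≼ {x} {y} x≤y) x≉y
        x≉z = λ x≈z → 1+n≢n (trans (sym ρz≡) (sym (ρ-cong {x} {z} x≈z)))
        -- The covering hypothesis only refutes that `z` differs from `y`; decidable equality of
        -- node and index turns this into an equality.
        z≈y = decidable-stable (i z ≟ i y ×-dec j z ≟ j y)
          (λ z≉y → none z (≼⇒≤P x≼z , x≉z) (≼⇒≤P z≼y , z≉y))
    in trans (sym (ρ-cong {z} {y} z≈y)) ρz≡

  reflect : Elem n → Elem n
  reflect x = elem (mirror (i x)) (j x) (mirror-pos (i x) (i-pos x))
    (subst (λ ℓ → ℓ + j x < n) (sym (level-mirror (i x) (i-pos x))) (bound x))

  reflect-len : ∀ x → len (reflect x) ≡ len x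
  reflect-len x = trans (cong length (path-mirror (i x) (i-pos x))) (length-map not (P x))

  reflect-cp : ∀ x y → cp (reflect x) (reflect y) ≡ cp x y
  reflect-cp x y = trans (cong₂ common (path-mirror (i x) (i-pos x)) (path-mirror (i y) (i-pos y)))
    (common-not (P x) (P y))

  reflect-automorphism : IsAutomorphism n reflect
  reflect-automorphism =
    (λ x y (i≡ , j≡) → trans (sym (mirror-involutive (i x) (i-pos x)))
      (trans (cong mirror i≡) (mirror-involutive (i y) (i-pos y))) , j≡) ,
    (λ y → reflect y , mirror-involutive (i y) (i-pos y) , refl) ,
    (λ x y → mk⇔
      (λ x≤y → ≼⇒≤P {reflect x} {reflect y} (below (subst₂ (λ a b → a + j x ≤ j y + b)
        (sym (reflect-len x)) (sym (reflect-cp x y)) (W≤j+cp (≤P⇒≼ {x} {y} x≤y)))))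
      (λ x≤y → ≼⇒≤P {x} {y} (below (subst₂ (λ a b → a + j x ≤ j y + b)
        (reflect-len x) (reflect-cp x y) (W≤j+cp (≤P⇒≼ {reflect x} {reflect y} x≤y))))))

  dual-antiautomorphism : IsAntiAutomorphism n dual
  dual-antiautomorphism =
    (λ x y (i≡ , j≡) → i≡ , trans (sym (proj₂ (dual-involutive x)))
      (trans (cong₂ (λ v m → n ∸ 1 ∸ level v ∸ m) i≡ j≡) (proj₂ (dual-involutive y)))) ,
    (λ y → dual y , dual-involutive y) ,
    (λ x y → mk⇔
      (λ x≤y → ≼⇒≤P {dual y} {dual x} (dual-anti (≤P⇒≼ {x} {y} x≤y)))
      (λ y≤x → ≼⇒≤P {x} {y} (dual-anti⁻¹ (≤P⇒≼ {dual y} {dual x} y≤x))))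

theorem6p3 : (n : ℕ) → 2 ≤ n →
    (∃[ join ] ∃[ meet ] IsRankedModularLattice n join meet) ×
    (∃[ φ ] (∀ x → (i (φ x) ≡ mirror (i x)) × (j (φ x) ≡ j x)) × IsAutomorphism n φ) ×
    (∃[ ψ ] (∀ x → (i (ψ x) ≡ i x) × (j (ψ x) ≡ n ∸ 1 ∸ level (i x) ∸ j x)) × IsAntiAutomorphism n ψ)
theorem6p3 n 2≤n =
  (join , meet , isLattice , modular , rank-valuation , covers) ,
  (reflect , (λ x → refl , refl) , reflect-automorphism) ,
  (dual , (λ x → refl , refl) , dual-antiautomorphism)
  where
  open Lattice-of-moves n
  open Conclusion n 2≤n
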